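{- Define polynomials by $P_1(x)=x$, $Q_1(x)=1$, and for $m>1$, $P_m(x)=P_{m-1}(x)^2+Q_{m-1}(x)^2$ and $Q_m(x)=P_{m-1}(x)Q_{m-1}(x)$. For $m\ge1$ let $B_m$ be the $m\times m$ coloring matrix with entries $b_{ij}=1$ if $i\ge j$ and $b_{ij}=0$ if $i<j$, and let $F^{(m)}(x)=\sum_{n\ge1}t_{B_m}^{(m)}(n)x^n$. Then for every $m\ge1$, $$x^{2^{m-1}}\left(\frac{1}{\sqrt{x}}Q_{m+1}\!\left(\frac{F^{(m)}(x)}{\sqrt{x}}\right)-P_{m+1}\!\left(\frac{F^{(m)}(x)}{\sqrt{x}}\right)\right)=0,$$ where the left-hand side, expanded, is a polynomial expression in $x$ and $F^{(m)}(x)$.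
   Context: A plane tree is an unlabeled rooted tree in which the children of every vertex are linearly ordered. A coloring matrix is an $m\times m$ matrix $A=(a_{ij})$ with entries in $\{0,1\}$. An $A$-coloring of a plane tree assigns to each vertex a color in $\{1,\dots,m\}$ such that whenever a vertex of color $j$ is a child of a vertex of color $i$, $a_{ij}=1$. Let $t_A^{(i)}(n)$ be the number of pairs (plane tree with $n$ vertices, $A$-coloring of it) in which the root has color $i$. -}

module Defs where

open import Algebra.Bundles.Raw using (RawRing)
import Algebra.Definitions.RawMonoid as RawMonoidDefinitions
import Algebra.Definitions.RawSemiring as RawSemiringDefinitions
open import Data.Bool.Base using (Bool; true)
import Data.Bool.Properties as Bool
open import Axiom.UniquenessOfIdentityProofs using (module Decidable⇒UIP)
open import Data.Fin.Base using (Fin; zero; suc; fromℕ; toℕ)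
open import Data.Fin.Properties using (_≤?_; 1↔⊤; +↔⊎; *↔×)
open import Data.Integer.Base using (ℤ; 0ℤ; 1ℤ; +_; +-0-rawMonoid)
import Data.Integer.Base as ℤ
open import Data.List.Base using (List; []; _∷_; map)
open import Data.List.Relation.Unary.All using (All; []; _∷_)
open import Data.Nat.Base using (ℕ; zero; suc; _∸_; NonZero; s<s⁻¹) renaming (_+_ to _ℕ+_; _*_ to _ℕ*_; _^_ to _ℕ^_; _<_ to _ℕ<_)
import Data.Nat.Properties as ℕ
open import Data.Product.Base using (Σ; ∃; _×_; _,_; proj₁)
open import Data.Product.Function.Dependent.Propositional using (Σ-↔)
open import Data.Product.Function.NonDependent.Propositional using (_×-↔_)
open import Data.Sum.Base using (_⊎_; inj₁; inj₂)
open import Data.Sum.Function.Propositional using (_⊎-↔_)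
open import Data.Unit.Base using (⊤; tt)
open import Function.Base using (_∘_)
open import Function.Bundles using (_↔_; mk↔ₛ′; Inverse)
open import Function.Construct.Composition using (_↔-∘_)
open import Function.Construct.Symmetry using (↔-sym)
open import Function.Construct.Identity using (↔-id)
open import Level using (0ℓ; Level)
open import Relation.Binary.PropositionalEquality using (_≡_; refl)
open import Relation.Nullary using (Dec; yes; no; does; Irrelevant; ¬_; contradiction)

data PlaneTree : Set where
  node : List PlaneTree → PlaneTree

mutual
  vertices : PlaneTree → ℕ
  vertices (node ts) = suc (vertices* ts)

  vertices* : List PlaneTree → ℕ
  vertices* []       = 0
  vertices* (t ∷ ts) = vertices t ℕ+ vertices* ts

-- An assignment of a color to every vertex, stored as a decoration of the
-- tree rather than as a function on vertices, so that two assignments are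
-- propositionally equal as soon as they agree at every vertex.
data Assignment (m : ℕ) : PlaneTree → Set where
  node : ∀ {ts} → Fin m → All (Assignment m) ts → Assignment m (node ts)

rootColor : ∀ {m t} → Assignment m t → Fin m
rootColor (node i _) = i

-- A 0/1 matrix; `true` is the entry 1.
ColoringMatrix : ℕ → Set
ColoringMatrix m = Fin m → Fin m → Bool

module _ {m : ℕ} (A : ColoringMatrix m) where

  mutual
    IsColoring : ∀ {t} → Assignment m t → Set
    IsColoring (node i cs) = AllowedBelow i cs

    AllowedBelow : ∀ {ts} → Fin m → All (Assignment m) ts → Set
    AllowedBelow i []       = ⊤
    AllowedBelow i (c ∷ cs) = A i (rootColor c) ≡ true × IsColoring c × AllowedBelow i cs

  record ColoredTree (i : Fin m) (n : ℕ) : Set where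
    constructor coloredTree
    field
      tree        : PlaneTree
      coloring    : Assignment m tree
      isColoring  : IsColoring coloring
      vertices≡n  : vertices tree ≡ n
      rootColor≡i : rootColor coloring ≡ i

Finite : Set → Set
Finite X = ∃ λ k → X ↔ Fin k

∣_∣ : {X : Set} → Finite X → ℕ
∣ fin ∣ = proj₁ fin

finite-↔ : ∀ {X Y} → X ↔ Y → Finite Y → Finite X
finite-↔ X↔Y (k , Y↔k) = k , (Y↔k ↔-∘ X↔Y)

finite-⊥ : ∀ {X} → ¬ X → Finite X
finite-⊥ ¬x = 0 , mk↔ₛ′ (λ x → contradiction x ¬x) (λ ()) (λ ()) (λ x → contradiction x ¬x)

finite-⊤ : Finite ⊤
finite-⊤ = 1 , ↔-sym 1↔⊤

finite-⊎ : ∀ {X Y} → Finite X → Finite Y → Finite (X ⊎ Y)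
finite-⊎ (k , X↔k) (l , Y↔l) = k ℕ+ l , (↔-sym +↔⊎ ↔-∘ (X↔k ⊎-↔ Y↔l))

finite-× : ∀ {X Y} → Finite X → Finite Y → Finite (X × Y)
finite-× (k , X↔k) (l , Y↔l) = k ℕ* l , (↔-sym *↔× ↔-∘ (X↔k ×-↔ Y↔l))

finite-Dec : ∀ {X} → Dec X → Irrelevant X → Finite X
finite-Dec (yes x) irr = finite-↔ (mk↔ₛ′ (λ _ → tt) (λ _ → x) (λ _ → refl) (irr x)) finite-⊤
finite-Dec (no ¬x) irr = finite-⊥ ¬x

finite-ΣFin : ∀ n {X : Fin n → Set} → (∀ i → Finite (X i)) → Finite (Σ (Fin n) X)
finite-ΣFin zero    fin = finite-⊥ λ ()
finite-ΣFin (suc n) {X} fin = finite-↔ split (finite-⊎ (fin zero) (finite-ΣFin n (fin ∘ suc)))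
  where
  split : Σ (Fin (suc n)) X ↔ (X zero ⊎ Σ (Fin n) (X ∘ suc))
  split = mk↔ₛ′
    (λ { (zero , x) → inj₁ x ; (suc i , x) → inj₂ (i , x) })
    (λ { (inj₁ x) → zero , x ; (inj₂ (i , x)) → suc i , x })
    (λ { (inj₁ _) → refl ; (inj₂ _) → refl })
    (λ { (zero , _) → refl ; (suc _ , _) → refl })

finite-Σ : ∀ {I} {X : I → Set} → Finite I → (∀ i → Finite (X i)) → Finite (Σ I X)
finite-Σ {X = X} (n , I↔n) fin =
  finite-↔ (↔-sym (Σ-↔ (↔-sym I↔n) (↔-id _)))
           (finite-ΣFin n {X ∘ Inverse.from I↔n} (fin ∘ Inverse.from I↔n))

Split : ℕ → Set
Split n = ∃ λ k → ∃ λ l → k ℕ+ l ≡ n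

finite-Split : ∀ n → Finite (Split n)
finite-Split zero = finite-↔ (mk↔ₛ′ (λ _ → tt) (λ _ → 0 , 0 , refl) (λ _ → refl) unique) finite-⊤
  where
  unique : (s : Split 0) → (0 , 0 , refl) ≡ s
  unique (zero , .0 , refl) = refl
finite-Split (suc n) = finite-↔ split (finite-⊎ finite-⊤ (finite-Split n))
  where
  split : Split (suc n) ↔ (⊤ ⊎ Split n)
  split = mk↔ₛ′
    (λ { (zero , _ , _) → inj₁ tt ; (suc k , l , refl) → inj₂ (k , l , refl) })
    (λ { (inj₁ _) → 0 , suc n , refl ; (inj₂ (k , l , refl)) → suc k , l , refl })
    (λ { (inj₁ _) → refl ; (inj₂ (_ , _ , refl)) → refl })
    (λ { (zero , _ , refl) → refl ; (suc _ , _ , refl) → refl })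

module _ {m : ℕ} (A : ColoringMatrix m) where

  record ColoredForest (i : Fin m) (n : ℕ) : Set where
    constructor coloredForest
    field
      trees        : List PlaneTree
      colorings    : All (Assignment m) trees
      allowedBelow : AllowedBelow A i colorings
      vertices*≡n  : vertices* trees ≡ n

  tree↔forest : ∀ {i n} → ColoredTree A i (suc n) ↔ ColoredForest i n
  tree↔forest = mk↔ₛ′
    (λ { (coloredTree (node ts) (node _ cs) ok refl refl) → coloredForest ts cs ok refl })
    (λ { (coloredForest ts cs ok refl) → coloredTree (node ts) (node _ cs) ok refl refl })
    (λ { (coloredForest _ _ _ refl) → refl })
    (λ { (coloredTree (node _) (node _ _) _ refl refl) → refl })

  emptyForest↔⊤ : ∀ {i} → ColoredForest i 0 ↔ ⊤
  emptyForest↔⊤ = mk↔ₛ′ (λ _ → tt) (λ _ → coloredForest [] [] tt refl) (λ _ → refl)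
    (λ { (coloredForest [] [] tt refl) → refl
       ; (coloredForest (node _ ∷ _) _ _ ()) })

  FirstTreeAndRest : Fin m → ℕ → Set
  FirstTreeAndRest i n =
    Σ (Fin m) λ j → Σ (Split n) λ { (k , l , _) →
      A i j ≡ true × ColoredForest j k × ColoredForest i l }

  forest↔first×rest : ∀ {i n} → ColoredForest i (suc n) ↔ FirstTreeAndRest i n
  forest↔first×rest = mk↔ₛ′
    (λ { (coloredForest (node us ∷ ts) (node j ds ∷ cs) (a , okᵈ , okᶜ) refl) →
           j , (vertices* us , vertices* ts , refl) , a ,
           coloredForest us ds okᵈ refl , coloredForest ts cs okᶜ refl })
    (λ { (j , (_ , _ , refl) , a , coloredForest us ds okᵈ refl , coloredForest ts cs okᶜ refl) →
           coloredForest (node us ∷ ts) (node j ds ∷ cs) (a , okᵈ , okᶜ) refl })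
    (λ { (_ , (_ , _ , refl) , _ , coloredForest _ _ _ refl , coloredForest _ _ _ refl) → refl })
    (λ { (coloredForest (node _ ∷ _) (node _ _ ∷ _) _ refl) → refl })

  finite-forest : ∀ bound i n → n ℕ< bound → Finite (ColoredForest i n)
  finite-forest (suc b) i zero    n<b = finite-↔ emptyForest↔⊤ finite-⊤
  finite-forest (suc b) i (suc n) n<b =
    finite-↔ forest↔first×rest
      (finite-ΣFin m λ j → finite-Σ (finite-Split n) λ { (k , l , refl) →
        finite-× (finite-Dec (A i j Bool.≟ true) (Decidable⇒UIP.≡-irrelevant Bool._≟_))
          (finite-× (finite-forest b j k (ℕ.≤-<-trans (ℕ.m≤m+n k l) (s<s⁻¹ n<b)))
                    (finite-forest b i l (ℕ.≤-<-trans (ℕ.m≤n+m l k) (s<s⁻¹ n<b)))) })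

  finite-tree : ∀ i n → Finite (ColoredTree A i n)
  finite-tree i zero    = finite-⊥ λ { (coloredTree (node _) _ _ () _) }
  finite-tree i (suc n) = finite-↔ tree↔forest (finite-forest (suc n) i n (ℕ.n<1+n n))

  t : Fin m → ℕ → ℕ
  t i n = ∣ finite-tree i n ∣

-- Coefficient lists, constant term first.
Polynomial : Set → Set
Polynomial R = List R

infixl 6 _+ₚ_
infixl 7 _*ₚ_

_+ₚ_ : Polynomial ℤ → Polynomial ℤ → Polynomial ℤ
[]      +ₚ q       = q
(a ∷ p) +ₚ []      = a ∷ p
(a ∷ p) +ₚ (b ∷ q) = (a ℤ.+ b) ∷ (p +ₚ q)

_*ₚ_ : Polynomial ℤ → Polynomial ℤ → Polynomial ℤ
[]      *ₚ q = []
(a ∷ p) *ₚ q = map (a ℤ.*_) q +ₚ (0ℤ ∷ (p *ₚ q))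

-- Evaluation at s, with the coefficients sent into S by φ.
module _ {c ℓ : Level} (S : RawRing c ℓ) where
  open RawRing S

  evaluate : {R : Set} → (R → Carrier) → Carrier → Polynomial R → Carrier
  evaluate φ s []      = 0#
  evaluate φ s (a ∷ p) = φ a + s * evaluate φ s p

mutual
  P : (m : ℕ) .{{_ : NonZero m}} → Polynomial ℤ
  P (suc zero)    = 0ℤ ∷ 1ℤ ∷ []
  P (suc (suc m)) = P (suc m) *ₚ P (suc m) +ₚ Q (suc m) *ₚ Q (suc m)

  Q : (m : ℕ) .{{_ : NonZero m}} → Polynomial ℤ
  Q (suc zero)    = 1ℤ ∷ []
  Q (suc (suc m)) = P (suc m) *ₚ Q (suc m)

PowerSeries : Set
PowerSeries = ℕ → ℤ

constant : ℤ → PowerSeries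
constant a zero    = a
constant a (suc _) = 0ℤ

powerSeries : RawRing 0ℓ 0ℓ
powerSeries = record
  { Carrier = PowerSeries
  ; _≈_     = λ f g → ∀ n → f n ≡ g n
  ; _+_     = λ f g n → f n ℤ.+ g n
  ; _*_     = λ f g n → sum {suc n} (λ k → f (toℕ k) ℤ.* g (n ∸ toℕ k))
  ; -_      = λ f n → ℤ.- f n
  ; 0#      = constant 0ℤ
  ; 1#      = constant 1ℤ
  }
  where open RawMonoidDefinitions +-0-rawMonoid using (sum)

-- Multiplication by the k-th power of the indeterminate.
shift : ℕ → PowerSeries → PowerSeries
shift zero    f n       = f n
shift (suc k) f zero    = 0ℤ
shift (suc k) f (suc n) = shift k f n

indeterminate : PowerSeries
indeterminate = shift 1 (constant 1ℤ)

-- `y^- d · f` is y⁻ᵈ f(y). The representation is not unique; equality is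
-- `_≈_` of `laurentSeries`, which compares after clearing the powers of y.
record LaurentSeries : Set where
  constructor y^-_·_
  field
    poleOrder : ℕ
    series    : PowerSeries

laurentSeries : RawRing 0ℓ 0ℓ
laurentSeries = record
  { Carrier = LaurentSeries
  ; _≈_     = λ { (y^- d · f) (y^- e · g) → shift e f ≈ shift d g }
  ; _+_     = λ { (y^- d · f) (y^- e · g) → y^- (d ℕ+ e) · (shift e f + shift d g) }
  ; _*_     = λ { (y^- d · f) (y^- e · g) → y^- (d ℕ+ e) · (f * g) }
  ; -_      = λ { (y^- d · f) → y^- d · (- f) }
  ; 0#      = y^- 0 · 0#
  ; 1#      = y^- 0 · 1#
  }
  where open RawRing powerSeries

-- f(x) ↦ f(y²) on coefficients.
substSquare : PowerSeries → PowerSeries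
substSquare f zero          = f 0
substSquare f (suc zero)    = 0ℤ
substSquare f (suc (suc n)) = substSquare (f ∘ suc) n

-- Series in x are regarded as Laurent series in y = √x.
inSqrt : PowerSeries → LaurentSeries
inSqrt f = y^- 0 · substSquare f

1/√x : LaurentSeries
1/√x = y^- 1 · constant 1ℤ

B : (m : ℕ) → ColoringMatrix m
B m i j = does (j ≤? i)

lastColor : (m : ℕ) .{{_ : NonZero m}} → Fin m
lastColor (suc m) = fromℕ m

F : (m : ℕ) .{{_ : NonZero m}} → PowerSeries
F m zero    = 0ℤ
F m (suc n) = + t (B m) (lastColor m) (suc n)

-- x^(2^(m-1)) ((1/√x) Q_{m+1}(G/√x) − P_{m+1}(G/√x)) for a series G in x.
leftHandSide : (m : ℕ) .{{_ : NonZero m}} → PowerSeries → LaurentSeries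
leftHandSide m G =
  x ^ (2 ℕ^ (m ∸ 1)) * (1/√x * at (Q (suc m)) + - at (P (suc m)))
  where
  open RawRing laurentSeries
  open RawSemiringDefinitions rawSemiring using (_^_)

  x : LaurentSeries
  x = inSqrt indeterminate

  at : Polynomial ℤ → LaurentSeries
  at = evaluate laurentSeries (inSqrt ∘ constant) (inSqrt G * 1/√x)

-- R(x, G) for R ∈ ℤ[x][z].
evaluate₂ : Polynomial (Polynomial ℤ) → PowerSeries → PowerSeries
evaluate₂ R G =
  evaluate powerSeries (evaluate powerSeries constant indeterminate) G R

{-# OPTIONS --safe #-}
module Submission where

-- Let T₁, …, Tₘ be the series of trees by root color and T₀ = x. Splitting off
-- the first subtree of the root gives Tᵢ = x + (T₁ + ⋯ + Tᵢ) Tᵢ, and eliminating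
-- the sum between consecutive colors gives Tᵢ₋₁ (Tᵢ² + x) = x Tᵢ. With uᵢ = Tᵢ/√x
-- this reads uᵢ₋₁ (1 + uᵢ²) = uᵢ, which matches the recursion of P and Q:
-- Qₖ₊₁(uₘ) = uₘ₋ₖ Pₖ₊₁(uₘ) for 1 ≤ k ≤ m. At k = m, u₀ = √x yields the equation.
-- Homogenising P and Q shows that only integral powers of x survive.

-- The two halves of the theorem are proved independently. Vanishing is a computation in Laurent
-- series in y = √x, where y is invertible. That the left-hand side is polynomial is shown for an
-- arbitrary series G in place of `F m`, by one R in ℤ[x][z] that does not depend on G. The exponent
-- 2^(m-1) is dictated by degrees: Pₘ₊₁ has degree 2^m and Qₘ₊₁ degree 2^m - 1, so √x^(2^m) clears
-- every denominator. For m ≥ 1 the former is even and the latter odd, so no odd power of √x is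
-- left. A Laurent series is a pole order with a numerator, and equality is tested after
-- cross-multiplication, so the ring laws must be established for fractions. They are proved over an
-- abstract commutative ring, as are the identities for P and Q; each step is then an identity in
-- variables instead of a computation with coefficients.

open import Defs
open import Algebra.Bundles using (CommutativeRing)
open import Algebra.Bundles.Raw using (RawRing)
import Algebra.Morphism.Construct.Composition as Composition
open import Algebra.Morphism.Structures using (module RingMorphisms)
import Algebra.Properties.AbelianGroup as GroupProperties
import Algebra.Properties.CommutativeMonoid.Sum as MonoidSum
import Algebra.Properties.Ring as RingProperties
import Algebra.Properties.Semiring.Exp as Exp
import Algebra.Solver.Ring.NaturalCoefficients.Default as SemiringSolver
open import Axiom.UniquenessOfIdentityProofs using (module Decidable⇒UIP)
open import Data.Bool.Base using (Bool; true; false; if_then_else_)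
import Data.Bool.Properties as Bool
open import Data.Fin.Base using (Fin; zero; suc; fromℕ; inject₁)
open import Data.Fin.Permutation using (↔⇒≡)
open import Data.Fin.Properties using (_≤?_)
open import Data.Integer.Base using (ℤ; 0ℤ; 1ℤ; +_; +-*-rawRing)
import Data.Integer.Base as ℤ
import Data.Integer.Properties as ℤ
open import Data.Integer.Solver using (module +-*-Solver)
open import Data.List.Base using ([]; _∷_; map)
open import Data.Nat.Base using (ℕ; zero; suc; NonZero) renaming (_+_ to _ℕ+_; _^_ to _ℕ^_)
import Data.Nat.Base as ℕ
import Data.Nat.Properties as ℕ
open import Data.Product.Base using (_×_; Σ; _,_; proj₁; proj₂)
open import Function.Base using (_∘_)
open import Function.Bundles using (Inverse)
open import Function.Construct.Composition using (_↔-∘_)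
open import Function.Construct.Symmetry using (↔-sym)
open import Level using (0ℓ; _⊔_)
import Relation.Binary.PropositionalEquality as ≡
open ≡ using (_≡_)
open import Relation.Nullary using (does)

open RingMorphisms using (IsRingHomomorphism)

-- Formal power series

module Series where
  open RawRing powerSeries public
  open ≡.≡-Reasoning

  scale : ℤ → PowerSeries → PowerSeries
  scale a f n = a ℤ.* f n

  -- The convolution peels off its first term definitionally: `(f * g) (suc n)` is
  -- `f 0 ℤ.* g (suc n)` plus `((f ∘ suc) * g) n`. Most laws below go by recursion on the index with
  -- a factor replaced by its tail; the `0ℤ` at index zero is the empty rest of the sum.
  *-cong : ∀ {f f′ g g′} → f ≈ f′ → g ≈ g′ → f * g ≈ f′ * g′
  *-cong p q zero    = ≡.cong₂ (λ a b → a ℤ.* b ℤ.+ 0ℤ) (p 0) (q 0)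
  *-cong p q (suc n) =
    ≡.cong₂ ℤ._+_ (≡.cong₂ ℤ._*_ (p 0) (q (suc n))) (*-cong (p ∘ suc) q n)

  distribʳ : ∀ h f g → (f + g) * h ≈ f * h + g * h
  distribʳ h f g zero =
    solve 3 (λ a b c → (a :+ b) :* c :+ con 0ℤ := (a :* c :+ con 0ℤ) :+ (b :* c :+ con 0ℤ)) ≡.refl (f 0) (g 0) (h 0)
    where open +-*-Solver
  distribʳ h f g (suc n) = begin
    (f 0 ℤ.+ g 0) ℤ.* h (suc n) ℤ.+ ((f ∘ suc + g ∘ suc) * h) n
      ≡⟨ ≡.cong (ℤ._+_ ((f 0 ℤ.+ g 0) ℤ.* h (suc n))) (distribʳ h (f ∘ suc) (g ∘ suc) n) ⟩
    (f 0 ℤ.+ g 0) ℤ.* h (suc n) ℤ.+ (((f ∘ suc) * h) n ℤ.+ ((g ∘ suc) * h) n)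
      ≡⟨ solve 5 (λ a b c d e → (a :+ b) :* c :+ (d :+ e) := (a :* c :+ d) :+ (b :* c :+ e)) ≡.refl
           (f 0) (g 0) (h (suc n)) (((f ∘ suc) * h) n) (((g ∘ suc) * h) n) ⟩
    (f * h + g * h) (suc n) ∎
    where open +-*-Solver

  scale-*ˡ : ∀ a f g → scale a f * g ≈ scale a (f * g)
  scale-*ˡ a f g zero =
    solve 3 (λ a b c → (a :* b) :* c :+ con 0ℤ := a :* (b :* c :+ con 0ℤ)) ≡.refl a (f 0) (g 0)
    where open +-*-Solver
  scale-*ˡ a f g (suc n) = begin
    a ℤ.* f 0 ℤ.* g (suc n) ℤ.+ (scale a (f ∘ suc) * g) n
      ≡⟨ ≡.cong (ℤ._+_ (a ℤ.* f 0 ℤ.* g (suc n))) (scale-*ˡ a (f ∘ suc) g n) ⟩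
    a ℤ.* f 0 ℤ.* g (suc n) ℤ.+ a ℤ.* ((f ∘ suc) * g) n
      ≡⟨ solve 4 (λ a b c d → a :* b :* c :+ a :* d := a :* (b :* c :+ d)) ≡.refl a (f 0) (g (suc n)) (((f ∘ suc) * g) n) ⟩
    scale a (f * g) (suc n) ∎
    where open +-*-Solver

  -- The tail of `f * g` is by definition `scale (f 0) (g ∘ suc) + (f ∘ suc) * g`, which is why
  -- distributivity and `scale-*ˡ` come first.
  *-assoc : ∀ f g h → (f * g) * h ≈ f * (g * h)
  *-assoc f g h zero =
    solve 3 (λ a b c → (a :* b :+ con 0ℤ) :* c :+ con 0ℤ := a :* (b :* c :+ con 0ℤ) :+ con 0ℤ) ≡.refl (f 0) (g 0) (h 0)
    where open +-*-Solver
  *-assoc f g h (suc n) = begin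
    (f 0 ℤ.* g 0 ℤ.+ 0ℤ) ℤ.* h (suc n) ℤ.+ ((scale (f 0) (g ∘ suc) + (f ∘ suc) * g) * h) n
      ≡⟨ ≡.cong (ℤ._+_ ((f 0 ℤ.* g 0 ℤ.+ 0ℤ) ℤ.* h (suc n))) (begin
           ((scale (f 0) (g ∘ suc) + (f ∘ suc) * g) * h) n
             ≡⟨ distribʳ h (scale (f 0) (g ∘ suc)) ((f ∘ suc) * g) n ⟩
           (scale (f 0) (g ∘ suc) * h) n ℤ.+ (((f ∘ suc) * g) * h) n
             ≡⟨ ≡.cong₂ ℤ._+_ (scale-*ˡ (f 0) (g ∘ suc) h n) (*-assoc (f ∘ suc) g h n) ⟩
           f 0 ℤ.* ((g ∘ suc) * h) n ℤ.+ ((f ∘ suc) * (g * h)) n ∎) ⟩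
    (f 0 ℤ.* g 0 ℤ.+ 0ℤ) ℤ.* h (suc n) ℤ.+ (f 0 ℤ.* ((g ∘ suc) * h) n ℤ.+ ((f ∘ suc) * (g * h)) n)
      ≡⟨ solve 5 (λ a b c d e → (a :* b :+ con 0ℤ) :* c :+ (a :* d :+ e) := a :* (b :* c :+ d) :+ e) ≡.refl
           (f 0) (g 0) (h (suc n)) (((g ∘ suc) * h) n) (((f ∘ suc) * (g * h)) n) ⟩
    (f * (g * h)) (suc n) ∎
    where open +-*-Solver

  -- Peels off the last term instead of the first. Commutativity exchanges the two ends of the
  -- convolution, and its definition exposes only the other one.
  *-suc : ∀ f g n → (f * g) (suc n) ≡ (f * (g ∘ suc)) n ℤ.+ f (suc n) ℤ.* g 0
  *-suc f g zero =
    solve 4 (λ a b c d → a :* d :+ (b :* c :+ con 0ℤ) := (a :* d :+ con 0ℤ) :+ b :* c) ≡.refl (f 0) (f 1) (g 0) (g 1)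
    where open +-*-Solver
  *-suc f g (suc n) = begin
    f 0 ℤ.* g (suc (suc n)) ℤ.+ ((f ∘ suc) * g) (suc n)
      ≡⟨ ≡.cong (ℤ._+_ (f 0 ℤ.* g (suc (suc n)))) (*-suc (f ∘ suc) g n) ⟩
    f 0 ℤ.* g (suc (suc n)) ℤ.+ (((f ∘ suc) * (g ∘ suc)) n ℤ.+ f (suc (suc n)) ℤ.* g 0)
      ≡⟨ ℤ.+-assoc (f 0 ℤ.* g (suc (suc n))) _ _ ⟨
    (f * (g ∘ suc)) (suc n) ℤ.+ f (suc (suc n)) ℤ.* g 0 ∎

  *-comm : ∀ f g → f * g ≈ g * f
  *-comm f g zero    = ≡.cong (ℤ._+ 0ℤ) (ℤ.*-comm (f 0) (g 0))
  *-comm f g (suc n) = begin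
    f 0 ℤ.* g (suc n) ℤ.+ ((f ∘ suc) * g) n
      ≡⟨ ≡.cong₂ ℤ._+_ (ℤ.*-comm (f 0) (g (suc n))) (*-comm (f ∘ suc) g n) ⟩
    g (suc n) ℤ.* f 0 ℤ.+ (g * (f ∘ suc)) n
      ≡⟨ ℤ.+-comm (g (suc n) ℤ.* f 0) _ ⟩
    (g * (f ∘ suc)) n ℤ.+ g (suc n) ℤ.* f 0
      ≡⟨ *-suc g f n ⟨
    (g * f) (suc n) ∎

  constant-0 : ∀ n → constant 0ℤ n ≡ 0ℤ
  constant-0 zero    = ≡.refl
  constant-0 (suc n) = ≡.refl

  zeroˡ : ∀ f g → (∀ n → f n ≡ 0ℤ) → ∀ n → (f * g) n ≡ 0ℤ
  zeroˡ f g p zero    rewrite p 0 = ≡.refl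
  zeroˡ f g p (suc n) rewrite p 0 | zeroˡ (f ∘ suc) g (p ∘ suc) n = ≡.refl

  constant-* : ∀ a f → constant a * f ≈ scale a f
  constant-* a f zero    = ℤ.+-identityʳ _
  constant-* a f (suc n) = begin
    a ℤ.* f (suc n) ℤ.+ ((constant a ∘ suc) * f) n
      ≡⟨ ≡.cong (ℤ._+_ (a ℤ.* f (suc n))) (zeroˡ (constant a ∘ suc) f (λ _ → ≡.refl) n) ⟩
    a ℤ.* f (suc n) ℤ.+ 0ℤ
      ≡⟨ ℤ.+-identityʳ _ ⟩
    scale a f (suc n) ∎

  *-identityˡ : ∀ f → 1# * f ≈ f
  *-identityˡ f n = ≡.trans (constant-* 1ℤ f n) (ℤ.*-identityˡ (f n))

  +-identityˡ : ∀ f → 0# + f ≈ f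
  +-identityˡ f n = ≡.trans (≡.cong (ℤ._+ f n) (constant-0 n)) (ℤ.+-identityˡ (f n))

  -‿inverseˡ : ∀ f → - f + f ≈ 0#
  -‿inverseˡ f n = ≡.trans (ℤ.+-inverseˡ (f n)) (≡.sym (constant-0 n))

powerSeriesRing : CommutativeRing 0ℓ 0ℓ
powerSeriesRing = record
  { RawRing powerSeries
  ; isCommutativeRing = record
    { isRing = record
      { +-isAbelianGroup = record
        { isGroup = record
          { isMonoid = record
            { isSemigroup = record
              { isMagma = record
                { isEquivalence = record
                  { refl  = λ n → ≡.refl
                  ; sym   = λ p n → ≡.sym (p n)
                  ; trans = λ p q n → ≡.trans (p n) (q n)
                  }
                ; ∙-cong = λ p q n → ≡.cong₂ ℤ._+_ (p n) (q n)
                }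
              ; assoc = λ f g h n → ℤ.+-assoc (f n) (g n) (h n)
              }
            ; identity = +-identityˡ , λ f n → ≡.trans (ℤ.+-comm (f n) (0# n)) (+-identityˡ f n)
            }
          ; inverse = -‿inverseˡ , λ f n → ≡.trans (ℤ.+-comm (f n) _) (-‿inverseˡ f n)
          ; ⁻¹-cong = λ p n → ≡.cong ℤ.-_ (p n)
          }
        ; comm = λ f g n → ℤ.+-comm (f n) (g n)
        }
      ; *-cong     = *-cong
      ; *-assoc    = *-assoc
      ; *-identity = *-identityˡ , λ f n → ≡.trans (*-comm f 1# n) (*-identityˡ f n)
      ; distrib    = (λ h f g n → ≡.trans (*-comm h (f + g) n)
                       (≡.trans (distribʳ h f g n) (≡.cong₂ ℤ._+_ (*-comm f h n) (*-comm g h n))))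
                   , distribʳ
      }
    ; *-comm = *-comm
    }
  }
  where open Series

constant-isRingHomomorphism : IsRingHomomorphism +-*-rawRing powerSeries constant
constant-isRingHomomorphism = record
  { isSemiringHomomorphism = record
    { isNearSemiringHomomorphism = record
      { +-isMonoidHomomorphism = record
        { isMagmaHomomorphism = record
          { isRelHomomorphism = record { cong = λ { ≡.refl n → ≡.refl } }
          ; homo = λ { a b zero → ≡.refl ; a b (suc n) → ≡.refl }
          }
        ; ε-homo = λ n → ≡.refl
        }
      ; *-homo = λ { a b zero    → ≡.sym (constant-* a (constant b) zero)
                   ; a b (suc n) → ≡.sym (≡.trans (constant-* a (constant b) (suc n)) (ℤ.*-zeroʳ a)) }
      }
    ; 1#-homo = λ n → ≡.refl
    }
  ; -‿homo = λ { a zero → ≡.refl ; a (suc n) → ≡.refl }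
  }
  where open Series

-- The substitution x = y²

module SubstSquare where
  open Series
  open ≡.≡-Reasoning

  substSquare-cong : ∀ {f g} → f ≈ g → substSquare f ≈ substSquare g
  substSquare-cong p zero          = p 0
  substSquare-cong p (suc zero)    = ≡.refl
  substSquare-cong p (suc (suc n)) = substSquare-cong (p ∘ suc) n

  substSquare-+ : ∀ f g → substSquare (f + g) ≈ substSquare f + substSquare g
  substSquare-+ f g zero          = ≡.refl
  substSquare-+ f g (suc zero)    = ≡.refl
  substSquare-+ f g (suc (suc n)) = substSquare-+ (f ∘ suc) (g ∘ suc) n

  substSquare-neg : ∀ f → substSquare (- f) ≈ - substSquare f
  substSquare-neg f zero          = ≡.refl
  substSquare-neg f (suc zero)    = ≡.refl
  substSquare-neg f (suc (suc n)) = substSquare-neg (f ∘ suc) n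

  substSquare-scale : ∀ a f → substSquare (scale a f) ≈ scale a (substSquare f)
  substSquare-scale a f zero          = ≡.refl
  substSquare-scale a f (suc zero)    = ≡.sym (ℤ.*-zeroʳ a)
  substSquare-scale a f (suc (suc n)) = substSquare-scale a (f ∘ suc) n

  substSquare-0 : ∀ f → (∀ n → f n ≡ 0ℤ) → ∀ n → substSquare f n ≡ 0ℤ
  substSquare-0 f p zero          = p 0
  substSquare-0 f p (suc zero)    = ≡.refl
  substSquare-0 f p (suc (suc n)) = substSquare-0 (f ∘ suc) (p ∘ suc) n

  substSquare-constant : ∀ a → substSquare (constant a) ≈ constant a
  substSquare-constant a zero          = ≡.refl
  substSquare-constant a (suc zero)    = ≡.refl
  substSquare-constant a (suc (suc n)) = substSquare-0 (constant a ∘ suc) (λ _ → ≡.refl) n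

  substSquare-* : ∀ f g → substSquare (f * g) ≈ substSquare f * substSquare g
  substSquare-* f g zero       = ≡.refl
  substSquare-* f g (suc zero) =
    ≡.sym (≡.cong (ℤ._+ 0ℤ) (ℤ.*-zeroʳ (f 0)))
  substSquare-* f g (suc (suc n)) = begin
    substSquare (scale (f 0) (g ∘ suc) + (f ∘ suc) * g) n
      ≡⟨ substSquare-+ (scale (f 0) (g ∘ suc)) ((f ∘ suc) * g) n ⟩
    substSquare (scale (f 0) (g ∘ suc)) n ℤ.+ substSquare ((f ∘ suc) * g) n
      ≡⟨ ≡.cong₂ ℤ._+_ (substSquare-scale (f 0) (g ∘ suc) n) (substSquare-* (f ∘ suc) g n) ⟩
    f 0 ℤ.* substSquare (g ∘ suc) n ℤ.+ (substSquare (f ∘ suc) * substSquare g) n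
      -- On the way to its next even index the left factor passes an odd coefficient, whose term is
      -- the extra zero summand.
      ≡⟨ ≡.cong (ℤ._+_ (f 0 ℤ.* substSquare (g ∘ suc) n)) (ℤ.+-identityˡ _) ⟨
    (substSquare f * substSquare g) (suc (suc n)) ∎

-- Laurent series

module Localisation {c ℓ} (R : CommutativeRing c ℓ) where
  open CommutativeRing R
  open SemiringSolver commutativeSemiring using (solve; _:=_; _:+_; _:*_)
  open RingProperties ring using (-‿distribʳ-*)
  open import Relation.Binary.Reasoning.Setoid setoid

  -- `sh k` is multiplication by the k-th power of a non-zero-divisor y. Below, a pair
  -- d, f of arguments stands for the fraction y⁻ᵈ f.
  record IsShift (sh : ℕ → Carrier → Carrier) : Set (c ⊔ ℓ) where
    field
      sh-0         : ∀ f → sh 0 f ≈ f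
      sh-+         : ∀ a b → sh (a ℕ+ b) 1# ≈ sh a 1# * sh b 1#
      sh-*         : ∀ k f → sh k f ≈ sh k 1# * f
      sh-injective : ∀ k {f g} → sh k f ≈ sh k g → f ≈ g

  module _ {sh : ℕ → Carrier → Carrier} (isShift : IsShift sh) where
    open IsShift isShift

    private
      y : ℕ → Carrier
      y k = sh k 1#

      -- Turning shifts into products makes the laws of fractions semiring identities in the powers
      -- of y and the numerators.
      sh-expand : ∀ k {z f g} → y k ≈ z → f ≈ g → sh k f ≈ z * g
      sh-expand k {z} {f} {g} p q = trans (sh-* k f) (*-cong p q)

      sh-expand₁ : ∀ k {f g} → f ≈ g → sh k f ≈ y k * g
      sh-expand₁ k = sh-expand k refl

      sh-expand₂ : ∀ a b {f g} → f ≈ g → sh (a ℕ+ b) f ≈ (y a * y b) * g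
      sh-expand₂ a b = sh-expand (a ℕ+ b) (sh-+ a b)

      y-+ˡ : ∀ a b d → y ((a ℕ+ b) ℕ+ d) ≈ (y a * y b) * y d
      y-+ˡ a b d = trans (sh-+ (a ℕ+ b) d) (*-congʳ (sh-+ a b))

      y-+ʳ : ∀ a b d → y (a ℕ+ (b ℕ+ d)) ≈ y a * (y b * y d)
      y-+ʳ a b d = trans (sh-+ a (b ℕ+ d)) (*-congˡ (sh-+ b d))

    -- The denominator of the middle fraction is absent from the conclusion, so both sides are
    -- multiplied by y to the power `e` and this factor is cancelled at the end; here y must be a
    -- non-zero-divisor.
    ≈-trans : ∀ d f e g h k → sh e f ≈ sh d g → sh h g ≈ sh e k → sh h f ≈ sh d k
    ≈-trans d f e g h k p q = sh-injective e (begin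
      sh e (sh h f)      ≈⟨ sh-expand₁ e (sh-* h f) ⟩
      y e * (y h * f)    ≈⟨ solve 3 (λ a b c → a :* (b :* c) := b :* (a :* c)) refl (y e) (y h) f ⟩
      y h * (y e * f)    ≈⟨ *-congˡ (trans (sym (sh-* e f)) (trans p (sh-* d g))) ⟩
      y h * (y d * g)    ≈⟨ solve 3 (λ a b c → a :* (b :* c) := b :* (a :* c)) refl (y h) (y d) g ⟩
      y d * (y h * g)    ≈⟨ *-congˡ (trans (sym (sh-* h g)) (trans q (sh-* e k))) ⟩
      y d * (y e * k)    ≈⟨ solve 3 (λ a b c → a :* (b :* c) := b :* (a :* c)) refl (y d) (y e) k ⟩
      y e * (y d * k)    ≈⟨ sh-expand₁ e (sh-* d k) ⟨
      sh e (sh d k)      ∎)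

    ≈-+-cong : ∀ d f d′ f′ e g e′ g′ → sh d′ f ≈ sh d f′ → sh e′ g ≈ sh e g′ →
               sh (d′ ℕ+ e′) (sh e f + sh d g) ≈ sh (d ℕ+ e) (sh e′ f′ + sh d′ g′)
    ≈-+-cong d f d′ f′ e g e′ g′ p q = begin
      sh (d′ ℕ+ e′) (sh e f + sh d g)
        ≈⟨ sh-expand₂ d′ e′ (+-cong (sh-* e f) (sh-* d g)) ⟩
      (y d′ * y e′) * (y e * f + y d * g)
        ≈⟨ solve 6 (λ d′ e′ d e f g → (d′ :* e′) :* (e :* f :+ d :* g) :=
                     (e′ :* e) :* (d′ :* f) :+ (d′ :* d) :* (e′ :* g)) refl (y d′) (y e′) (y d) (y e) f g ⟩
      (y e′ * y e) * (y d′ * f) + (y d′ * y d) * (y e′ * g)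
        ≈⟨ +-cong (*-congˡ (trans (sym (sh-* d′ f)) (trans p (sh-* d f′))))
                  (*-congˡ (trans (sym (sh-* e′ g)) (trans q (sh-* e g′)))) ⟩
      (y e′ * y e) * (y d * f′) + (y d′ * y d) * (y e * g′)
        ≈⟨ solve 6 (λ d′ e′ d e f g → (e′ :* e) :* (d :* f) :+ (d′ :* d) :* (e :* g) :=
                     (d :* e) :* (e′ :* f :+ d′ :* g)) refl (y d′) (y e′) (y d) (y e) f′ g′ ⟩
      (y d * y e) * (y e′ * f′ + y d′ * g′)
        ≈⟨ sh-expand₂ d e (+-cong (sh-* e′ f′) (sh-* d′ g′)) ⟨
      sh (d ℕ+ e) (sh e′ f′ + sh d′ g′) ∎

    ≈-*-cong : ∀ d f d′ f′ e g e′ g′ → sh d′ f ≈ sh d f′ → sh e′ g ≈ sh e g′ →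
               sh (d′ ℕ+ e′) (f * g) ≈ sh (d ℕ+ e) (f′ * g′)
    ≈-*-cong d f d′ f′ e g e′ g′ p q = begin
      sh (d′ ℕ+ e′) (f * g)
        ≈⟨ sh-expand₂ d′ e′ refl ⟩
      (y d′ * y e′) * (f * g)
        ≈⟨ solve 4 (λ a b c d → (a :* b) :* (c :* d) := (a :* c) :* (b :* d)) refl (y d′) (y e′) f g ⟩
      (y d′ * f) * (y e′ * g)
        ≈⟨ *-cong (trans (sym (sh-* d′ f)) (trans p (sh-* d f′)))
                  (trans (sym (sh-* e′ g)) (trans q (sh-* e g′))) ⟩
      (y d * f′) * (y e * g′)
        ≈⟨ solve 4 (λ a b c d → (a :* b) :* (c :* d) := (a :* c) :* (b :* d)) refl (y d) f′ (y e) g′ ⟩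
      (y d * y e) * (f′ * g′)
        ≈⟨ sh-expand₂ d e refl ⟨
      sh (d ℕ+ e) (f′ * g′) ∎

    ≈-neg-cong : ∀ d f d′ f′ → sh d′ f ≈ sh d f′ → sh d′ (- f) ≈ sh d (- f′)
    ≈-neg-cong d f d′ f′ p = begin
      sh d′ (- f)      ≈⟨ sh-* d′ (- f) ⟩
      y d′ * - f       ≈⟨ -‿distribʳ-* (y d′) f ⟨
      - (y d′ * f)     ≈⟨ -‿cong (trans (sym (sh-* d′ f)) (trans p (sh-* d f′))) ⟩
      - (y d * f′)     ≈⟨ -‿distribʳ-* (y d) f′ ⟩
      y d * - f′       ≈⟨ sh-* d (- f′) ⟨
      sh d (- f′)      ∎

    ≈-+-assoc : ∀ d f e g h k →
                sh (d ℕ+ (e ℕ+ h)) (sh h (sh e f + sh d g) + sh (d ℕ+ e) k) ≈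
                sh ((d ℕ+ e) ℕ+ h) (sh (e ℕ+ h) f + sh d (sh h g + sh e k))
    ≈-+-assoc d f e g h k = begin
      sh (d ℕ+ (e ℕ+ h)) (sh h (sh e f + sh d g) + sh (d ℕ+ e) k)
        ≈⟨ sh-expand (d ℕ+ (e ℕ+ h)) (y-+ʳ d e h)
             (+-cong (sh-expand₁ h (+-cong (sh-* e f) (sh-* d g))) (sh-expand₂ d e refl)) ⟩
      (y d * (y e * y h)) * (y h * (y e * f + y d * g) + (y d * y e) * k)
        ≈⟨ solve 6 (λ d e h f g k →
             (d :* (e :* h)) :* (h :* (e :* f :+ d :* g) :+ (d :* e) :* k) :=
             ((d :* e) :* h) :* ((e :* h) :* f :+ d :* (h :* g :+ e :* k))) refl (y d) (y e) (y h) f g k ⟩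
      ((y d * y e) * y h) * ((y e * y h) * f + y d * (y h * g + y e * k))
        ≈⟨ sh-expand ((d ℕ+ e) ℕ+ h) (y-+ˡ d e h)
             (+-cong (sh-expand₂ e h refl) (sh-expand₁ d (+-cong (sh-* h g) (sh-* e k)))) ⟨
      sh ((d ℕ+ e) ℕ+ h) (sh (e ℕ+ h) f + sh d (sh h g + sh e k)) ∎

    ≈-+-comm : ∀ d f e g → sh (e ℕ+ d) (sh e f + sh d g) ≈ sh (d ℕ+ e) (sh d g + sh e f)
    ≈-+-comm d f e g = begin
      sh (e ℕ+ d) (sh e f + sh d g)    ≈⟨ sh-expand₂ e d (+-comm (sh e f) (sh d g)) ⟩
      (y e * y d) * (sh d g + sh e f)  ≈⟨ *-congʳ (*-comm (y e) (y d)) ⟩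
      (y d * y e) * (sh d g + sh e f)  ≈⟨ sh-expand₂ d e refl ⟨
      sh (d ℕ+ e) (sh d g + sh e f)    ∎

    ≈-+-identityˡ : ∀ d f → sh d (sh d 0# + sh 0 f) ≈ sh d f
    ≈-+-identityˡ d f = begin
      sh d (sh d 0# + sh 0 f)  ≈⟨ sh-expand₁ d (+-cong (trans (sh-* d 0#) (zeroʳ (y d))) (sh-0 f)) ⟩
      y d * (0# + f)           ≈⟨ *-congˡ (+-identityˡ f) ⟩
      y d * f                  ≈⟨ sh-* d f ⟨
      sh d f                   ∎

    ≈-inverseˡ : ∀ d f → sh 0 (sh d (- f) + sh d f) ≈ sh (d ℕ+ d) 0#
    ≈-inverseˡ d f = begin
      sh 0 (sh d (- f) + sh d f)  ≈⟨ sh-0 _ ⟩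
      sh d (- f) + sh d f         ≈⟨ +-cong (sh-* d (- f)) (sh-* d f) ⟩
      y d * - f + y d * f         ≈⟨ distribˡ (y d) (- f) f ⟨
      y d * (- f + f)             ≈⟨ *-congˡ (-‿inverseˡ f) ⟩
      y d * 0#                    ≈⟨ zeroʳ (y d) ⟩
      0#                          ≈⟨ zeroʳ (y (d ℕ+ d)) ⟨
      y (d ℕ+ d) * 0#             ≈⟨ sh-* (d ℕ+ d) 0# ⟨
      sh (d ℕ+ d) 0#              ∎

    ≈-*-assoc : ∀ d f e g h k → sh (d ℕ+ (e ℕ+ h)) ((f * g) * k) ≈ sh ((d ℕ+ e) ℕ+ h) (f * (g * k))
    ≈-*-assoc d f e g h k = begin
      sh (d ℕ+ (e ℕ+ h)) ((f * g) * k)     ≈⟨ sh-expand (d ℕ+ (e ℕ+ h)) (y-+ʳ d e h) (*-assoc f g k) ⟩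
      (y d * (y e * y h)) * (f * (g * k))  ≈⟨ *-congʳ (*-assoc (y d) (y e) (y h)) ⟨
      ((y d * y e) * y h) * (f * (g * k))  ≈⟨ sh-expand ((d ℕ+ e) ℕ+ h) (y-+ˡ d e h) refl ⟨
      sh ((d ℕ+ e) ℕ+ h) (f * (g * k))     ∎

    ≈-*-comm : ∀ d f e g → sh (e ℕ+ d) (f * g) ≈ sh (d ℕ+ e) (g * f)
    ≈-*-comm d f e g = begin
      sh (e ℕ+ d) (f * g)    ≈⟨ sh-expand₂ e d (*-comm f g) ⟩
      (y e * y d) * (g * f)  ≈⟨ *-congʳ (*-comm (y e) (y d)) ⟩
      (y d * y e) * (g * f)  ≈⟨ sh-expand₂ d e refl ⟨
      sh (d ℕ+ e) (g * f)    ∎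

    ≈-*-identityˡ : ∀ d f → sh d (1# * f) ≈ sh d f
    ≈-*-identityˡ d f = trans (sh-expand₁ d (*-identityˡ f)) (sym (sh-* d f))

    ≈-distribʳ : ∀ h k d f e g →
                 sh ((d ℕ+ h) ℕ+ (e ℕ+ h)) ((sh e f + sh d g) * k) ≈
                 sh ((d ℕ+ e) ℕ+ h) (sh (e ℕ+ h) (f * k) + sh (d ℕ+ h) (g * k))
    ≈-distribʳ h k d f e g = begin
      sh ((d ℕ+ h) ℕ+ (e ℕ+ h)) ((sh e f + sh d g) * k)
        ≈⟨ sh-expand ((d ℕ+ h) ℕ+ (e ℕ+ h))
             (trans (sh-+ (d ℕ+ h) (e ℕ+ h)) (*-cong (sh-+ d h) (sh-+ e h)))
             (*-congʳ (+-cong (sh-* e f) (sh-* d g))) ⟩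
      ((y d * y h) * (y e * y h)) * ((y e * f + y d * g) * k)
        ≈⟨ solve 6 (λ d e h f g k →
             ((d :* h) :* (e :* h)) :* ((e :* f :+ d :* g) :* k) :=
             ((d :* e) :* h) :* ((e :* h) :* (f :* k) :+ (d :* h) :* (g :* k))) refl (y d) (y e) (y h) f g k ⟩
      ((y d * y e) * y h) * ((y e * y h) * (f * k) + (y d * y h) * (g * k))
        ≈⟨ sh-expand ((d ℕ+ e) ℕ+ h) (y-+ˡ d e h) (+-cong (sh-expand₂ e h refl) (sh-expand₂ d h refl)) ⟨
      sh ((d ℕ+ e) ℕ+ h) (sh (e ℕ+ h) (f * k) + sh (d ℕ+ h) (g * k)) ∎

module _ where
  open Series
  open Localisation powerSeriesRing using (IsShift)

  shift-* : ∀ k f → shift k f ≈ shift k 1# * f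
  shift-* zero    f n       = ≡.sym (*-identityˡ f n)
  shift-* (suc k) f zero    = ≡.refl
  shift-* (suc k) f (suc n) = ≡.trans (shift-* k f n) (≡.sym (ℤ.+-identityˡ _))

  shift-+ : ∀ a b f → shift (a ℕ+ b) f ≈ shift a (shift b f)
  shift-+ zero    b f n       = ≡.refl
  shift-+ (suc a) b f zero    = ≡.refl
  shift-+ (suc a) b f (suc n) = shift-+ a b f n

  shift-injective : ∀ k {f g} → shift k f ≈ shift k g → f ≈ g
  shift-injective zero    p = p
  shift-injective (suc k) p = shift-injective k (p ∘ suc)

  shift-isShift : IsShift shift
  shift-isShift = record
    { sh-0         = λ f n → ≡.refl
    ; sh-+         = λ a b n → ≡.trans (shift-+ a b 1# n) (shift-* a (shift b 1#) n)
    ; sh-*         = shift-*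
    ; sh-injective = shift-injective
    }

laurentSeriesRing : CommutativeRing 0ℓ 0ℓ
laurentSeriesRing = record
  { RawRing laurentSeries
  ; isCommutativeRing = record
    { isRing = record
      { +-isAbelianGroup = record
        { isGroup = record
          { isMonoid = record
            { isSemigroup = record
              { isMagma = record
                { isEquivalence = record
                  { refl  = λ n → ≡.refl
                  ; sym   = λ p n → ≡.sym (p n)
                  ; trans = λ { {y^- d · f} {y^- e · g} {y^- h · k} → ≈-trans I d f e g h k }
                  }
                ; ∙-cong = λ { {y^- d · f} {y^- d′ · f′} {y^- e · g} {y^- e′ · g′} →
                               ≈-+-cong I d f d′ f′ e g e′ g′ }
                }
              ; assoc = λ { (y^- d · f) (y^- e · g) (y^- h · k) → ≈-+-assoc I d f e g h k }
              }
            ; identity = identityˡ , λ a → trans′ (a + 0#) (0# + a) a (+-comm a 0#) (identityˡ a)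
            }
          ; inverse = inverseˡ , λ a → trans′ (a + - a) (- a + a) 0# (+-comm a (- a)) (inverseˡ a)
          ; ⁻¹-cong = λ { {y^- d · f} {y^- d′ · f′} → ≈-neg-cong I d f d′ f′ }
          }
        ; comm = +-comm
        }
      ; *-cong     = λ { {y^- d · f} {y^- d′ · f′} {y^- e · g} {y^- e′ · g′} →
                         ≈-*-cong I d f d′ f′ e g e′ g′ }
      ; *-assoc    = λ { (y^- d · f) (y^- e · g) (y^- h · k) → ≈-*-assoc I d f e g h k }
      ; *-identity = *-identityˡ , λ a → trans′ (a * 1#) (1# * a) a (*-comm a 1#) (*-identityˡ a)
      ; distrib    = (λ c a b → trans′ (c * (a + b)) ((a + b) * c) ((c * a) + (c * b))
                        (*-comm c (a + b))
                        (trans′ ((a + b) * c) ((a * c) + (b * c)) ((c * a) + (c * b))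
                          (distribʳ c a b)
                          (+-cong (a * c) (c * a) (b * c) (c * b) (*-comm a c) (*-comm b c))))
                   , distribʳ
      }
    ; *-comm = *-comm
    }
  }
  where
  open Localisation powerSeriesRing
  I = shift-isShift
  open RawRing laurentSeries

  -- The fractions are passed explicitly, because an equation of Laurent series unfolds to one of
  -- shifted power series, from which pole orders and numerators cannot be recovered.
  trans′ : ∀ a b c → a ≈ b → b ≈ c → a ≈ c
  trans′ (y^- d · f) (y^- e · g) (y^- h · k) = ≈-trans I d f e g h k

  +-cong : ∀ a a′ b b′ → a ≈ a′ → b ≈ b′ → (a + b) ≈ (a′ + b′)
  +-cong (y^- d · f) (y^- d′ · f′) (y^- e · g) (y^- e′ · g′) = ≈-+-cong I d f d′ f′ e g e′ g′

  +-comm : ∀ a b → (a + b) ≈ (b + a)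
  +-comm (y^- d · f) (y^- e · g) = ≈-+-comm I d f e g

  *-comm : ∀ a b → (a * b) ≈ (b * a)
  *-comm (y^- d · f) (y^- e · g) = ≈-*-comm I d f e g

  identityˡ : ∀ a → (0# + a) ≈ a
  identityˡ (y^- d · f) = ≈-+-identityˡ I d f

  inverseˡ : ∀ a → - a + a ≈ 0#
  inverseˡ (y^- d · f) = ≈-inverseˡ I d f

  *-identityˡ : ∀ a → (1# * a) ≈ a
  *-identityˡ (y^- d · f) = ≈-*-identityˡ I d f

  distribʳ : ∀ c a b → ((a + b) * c) ≈ ((a * c) + (b * c))
  distribʳ (y^- h · k) (y^- d · f) (y^- e · g) = ≈-distribʳ I h k d f e g

-- All images have pole order zero, so there is no power of y to clear and each law is one of
-- `substSquare`.
inSqrt-isRingHomomorphism : IsRingHomomorphism powerSeries laurentSeries inSqrt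
inSqrt-isRingHomomorphism = record
  { isSemiringHomomorphism = record
    { isNearSemiringHomomorphism = record
      { +-isMonoidHomomorphism = record
        { isMagmaHomomorphism = record
          { isRelHomomorphism = record { cong = substSquare-cong }
          ; homo = substSquare-+
          }
        ; ε-homo = substSquare-constant 0ℤ
        }
      ; *-homo = substSquare-*
      }
    ; 1#-homo = substSquare-constant 1ℤ
    }
  ; -‿homo = substSquare-neg
  }
  where open SubstSquare

-- Polynomials and their evaluation

-- The coefficients are a parameter so that the construction can be iterated to ℤ[x][z].
module PolynomialArithmetic (A : RawRing 0ℓ 0ℓ) where
  open RawRing A

  infixl 6 _⊕_
  infixl 7 _⊗_

  _⊕_ : Polynomial Carrier → Polynomial Carrier → Polynomial Carrier
  []      ⊕ q       = q
  (a ∷ p) ⊕ []      = a ∷ p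
  (a ∷ p) ⊕ (b ∷ q) = (a + b) ∷ (p ⊕ q)

  _⊗_ : Polynomial Carrier → Polynomial Carrier → Polynomial Carrier
  []      ⊗ q = []
  (a ∷ p) ⊗ q = map (a *_) q ⊕ (0# ∷ (p ⊗ q))

  -- Coefficient lists under `_≡_` are not a ring, since p - p is a list of zeros and not `[]`. A
  -- raw ring is enough for the source of a homomorphism.
  polynomials : RawRing 0ℓ 0ℓ
  polynomials = record
    { Carrier = Polynomial Carrier
    ; _≈_     = _≡_
    ; _+_     = _⊕_
    ; _*_     = _⊗_
    ; -_      = map -_
    ; 0#      = []
    ; 1#      = 1# ∷ []
    }

open PolynomialArithmetic using (polynomials)

module _ where
  open PolynomialArithmetic +-*-rawRing

  +ₚ≡⊕ : ∀ p q → p +ₚ q ≡ p ⊕ q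
  +ₚ≡⊕ []      q       = ≡.refl
  +ₚ≡⊕ (a ∷ p) []      = ≡.refl
  +ₚ≡⊕ (a ∷ p) (b ∷ q) = ≡.cong ((a ℤ.+ b) ∷_) (+ₚ≡⊕ p q)

  *ₚ≡⊗ : ∀ p q → p *ₚ q ≡ p ⊗ q
  *ₚ≡⊗ []      q = ≡.refl
  *ₚ≡⊗ (a ∷ p) q = ≡.trans (+ₚ≡⊕ (map (a ℤ.*_) q) (0ℤ ∷ (p *ₚ q)))
                           (≡.cong (λ r → map (a ℤ.*_) q ⊕ (0ℤ ∷ r)) (*ₚ≡⊗ p q))

module Evaluation {c ℓ} (S : CommutativeRing c ℓ) {A : RawRing 0ℓ 0ℓ}
  {φ : RawRing.Carrier A → CommutativeRing.Carrier S}
  (φ-homo : IsRingHomomorphism A (CommutativeRing.rawRing S) φ)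
  (s : CommutativeRing.Carrier S) where

  open CommutativeRing S hiding (zero)
  open PolynomialArithmetic A using (_⊕_; _⊗_)
  open SemiringSolver commutativeSemiring using (solve; _:=_; _:+_; _:*_; con)
  open RingProperties ring using (-‿distribʳ-*; -‿+-comm; -0#≈0#)
  open import Relation.Binary.Reasoning.Setoid setoid
  private
    module A = RawRing A
    module φ = IsRingHomomorphism φ-homo

    ev : Polynomial A.Carrier → Carrier
    ev = evaluate rawRing φ s

  evaluate-⊕ : ∀ p q → ev (p ⊕ q) ≈ ev p + ev q
  evaluate-⊕ []      q       = sym (+-identityˡ (ev q))
  evaluate-⊕ (a ∷ p) []      = sym (+-identityʳ (ev (a ∷ p)))
  evaluate-⊕ (a ∷ p) (b ∷ q) = begin
    φ (a A.+ b) + s * ev (p ⊕ q)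
      ≈⟨ +-cong (φ.+-homo a b) (*-congˡ (evaluate-⊕ p q)) ⟩
    (φ a + φ b) + s * (ev p + ev q)
      ≈⟨ solve 5 (λ a b s p q → (a :+ b) :+ s :* (p :+ q) := (a :+ s :* p) :+ (b :+ s :* q)) refl
           (φ a) (φ b) s (ev p) (ev q) ⟩
    (φ a + s * ev p) + (φ b + s * ev q) ∎

  evaluate-map-* : ∀ a q → ev (map (a A.*_) q) ≈ φ a * ev q
  evaluate-map-* a []      = sym (zeroʳ (φ a))
  evaluate-map-* a (b ∷ q) = begin
    φ (a A.* b) + s * ev (map (a A.*_) q)
      ≈⟨ +-cong (φ.*-homo a b) (*-congˡ (evaluate-map-* a q)) ⟩
    φ a * φ b + s * (φ a * ev q)
      ≈⟨ solve 4 (λ a b s q → a :* b :+ s :* (a :* q) := a :* (b :+ s :* q)) refl (φ a) (φ b) s (ev q) ⟩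
    φ a * (φ b + s * ev q) ∎

  evaluate-⊗ : ∀ p q → ev (p ⊗ q) ≈ ev p * ev q
  evaluate-⊗ []      q = sym (zeroˡ (ev q))
  evaluate-⊗ (a ∷ p) q = begin
    ev (map (a A.*_) q ⊕ (A.0# ∷ (p ⊗ q)))
      ≈⟨ evaluate-⊕ (map (a A.*_) q) (A.0# ∷ (p ⊗ q)) ⟩
    ev (map (a A.*_) q) + (φ A.0# + s * ev (p ⊗ q))
      ≈⟨ +-cong (evaluate-map-* a q) (+-cong φ.0#-homo (*-congˡ (evaluate-⊗ p q))) ⟩
    φ a * ev q + (0# + s * (ev p * ev q))
      ≈⟨ solve 4 (λ a s p q → a :* q :+ (con 0 :+ s :* (p :* q)) := (a :+ s :* p) :* q) refl
           (φ a) s (ev p) (ev q) ⟩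
    (φ a + s * ev p) * ev q ∎

  evaluate-neg : ∀ p → ev (map A.-_ p) ≈ - ev p
  evaluate-neg []      = sym -0#≈0#
  evaluate-neg (a ∷ p) = begin
    φ (A.- a) + s * ev (map A.-_ p)  ≈⟨ +-cong (φ.-‿homo a) (*-congˡ (evaluate-neg p)) ⟩
    - φ a + s * - ev p               ≈⟨ +-congˡ (-‿distribʳ-* s (ev p)) ⟨
    - φ a + - (s * ev p)             ≈⟨ -‿+-comm (φ a) (s * ev p) ⟩
    - (φ a + s * ev p)               ∎

  evaluate-const : ∀ a → ev (a ∷ []) ≈ φ a
  evaluate-const a = trans (+-congˡ (zeroʳ s)) (+-identityʳ (φ a))

  evaluate-indeterminate : ev (A.0# ∷ A.1# ∷ []) ≈ s
  evaluate-indeterminate = begin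
    φ A.0# + s * ev (A.1# ∷ [])  ≈⟨ +-cong φ.0#-homo (*-congˡ (trans (evaluate-const A.1#) φ.1#-homo)) ⟩
    0# + s * 1#                  ≈⟨ solve 1 (λ s → con 0 :+ s :* con 1 := s) refl s ⟩
    s                            ∎

  evaluate-isRingHomomorphism : IsRingHomomorphism (polynomials A) rawRing ev
  evaluate-isRingHomomorphism = record
    { isSemiringHomomorphism = record
      { isNearSemiringHomomorphism = record
        { +-isMonoidHomomorphism = record
          { isMagmaHomomorphism = record
            { isRelHomomorphism = record { cong = λ p≡q → reflexive (≡.cong ev p≡q) }
            ; homo = evaluate-⊕
            }
          ; ε-homo = refl
          }
        ; *-homo = evaluate-⊗
        }
      ; 1#-homo = trans (evaluate-const A.1#) φ.1#-homo
      }
    ; -‿homo = evaluate-neg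
    }

-- Values of P and Q along a sequence

module EvaluatePQ {c ℓ} (S : CommutativeRing c ℓ) {φ : ℤ → CommutativeRing.Carrier S}
  (φ-homo : IsRingHomomorphism +-*-rawRing (CommutativeRing.rawRing S) φ) where

  open CommutativeRing S hiding (zero)
  open SemiringSolver commutativeSemiring using (solve; _:=_; _:+_; _:*_; con)
  open import Relation.Binary.Reasoning.Setoid setoid

  at : Carrier → Polynomial ℤ → Carrier
  at = evaluate rawRing φ

  at-+ₚ : ∀ u p q → at u (p +ₚ q) ≈ at u p + at u q
  at-+ₚ u p q = trans (reflexive (≡.cong (at u) (+ₚ≡⊕ p q))) (Evaluation.evaluate-⊕ S φ-homo u p q)

  at-*ₚ : ∀ u p q → at u (p *ₚ q) ≈ at u p * at u q
  at-*ₚ u p q = trans (reflexive (≡.cong (at u) (*ₚ≡⊗ p q))) (Evaluation.evaluate-⊗ S φ-homo u p q)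

  at-P₁ : ∀ u → at u (P 1) ≈ u
  at-P₁ u = Evaluation.evaluate-indeterminate S φ-homo u

  at-Q₁ : ∀ u → at u (Q 1) ≈ 1#
  at-Q₁ u = trans (Evaluation.evaluate-const S φ-homo u 1ℤ) (IsRingHomomorphism.1#-homo φ-homo)

  at-P : ∀ u m → at u (P (suc (suc m))) ≈
                 at u (P (suc m)) * at u (P (suc m)) + at u (Q (suc m)) * at u (Q (suc m))
  at-P u m = trans (at-+ₚ u (P (suc m) *ₚ P (suc m)) (Q (suc m) *ₚ Q (suc m)))
    (+-cong (at-*ₚ u (P (suc m)) (P (suc m))) (at-*ₚ u (Q (suc m)) (Q (suc m))))

  at-Q : ∀ u m → at u (Q (suc (suc m))) ≈ at u (P (suc m)) * at u (Q (suc m))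
  at-Q u m = at-*ₚ u (P (suc m)) (Q (suc m))

  -- The evaluation point is the last entry of the sequence and survives when the first entry is
  -- dropped, so the induction hypothesis applies to `u ∘ suc`. If Q = u₁ P, then the next pair is
  -- PQ = u₁ P² and P² + Q² = (1 + u₁²) P², and u₁ = u₀ (1 + u₁²).
  Q≈u₀P : ∀ m (u : Fin (suc (suc m)) → Carrier) →
          (∀ i → u (inject₁ i) * (1# + u (suc i) * u (suc i)) ≈ u (suc i)) →
          at (u (fromℕ (suc m))) (Q (suc (suc m))) ≈ u zero * at (u (fromℕ (suc m))) (P (suc (suc m)))
  Q≈u₀P zero u step = begin
    at u₁ (Q 2)                                               ≈⟨ at-Q u₁ 0 ⟩
    at u₁ (P 1) * at u₁ (Q 1)                                 ≈⟨ *-cong (at-P₁ u₁) (at-Q₁ u₁) ⟩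
    u₁ * 1#                                                   ≈⟨ *-identityʳ u₁ ⟩
    u₁                                                        ≈⟨ step zero ⟨
    u₀ * (1# + u₁ * u₁)
      ≈⟨ solve 2 (λ a b → a :* (con 1 :+ b :* b) := a :* (b :* b :+ con 1 :* con 1)) refl u₀ u₁ ⟩
    u₀ * (u₁ * u₁ + 1# * 1#)
      ≈⟨ *-congˡ (+-cong (*-cong (at-P₁ u₁) (at-P₁ u₁)) (*-cong (at-Q₁ u₁) (at-Q₁ u₁))) ⟨
    u₀ * (at u₁ (P 1) * at u₁ (P 1) + at u₁ (Q 1) * at u₁ (Q 1))  ≈⟨ *-congˡ (at-P u₁ 0) ⟨
    u₀ * at u₁ (P 2)                                          ∎
    where
    u₀ = u zero
    u₁ = u (suc zero)
  Q≈u₀P (suc m) u step = begin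
    at v (Q (suc (suc (suc m))))         ≈⟨ at-Q v (suc m) ⟩
    p * q                                ≈⟨ *-congˡ q≈u₁p ⟩
    -- The relation is used from right to left, which avoids dividing by 1 + u₁².
    p * (u₁ * p)                         ≈⟨ *-congˡ (*-congʳ (step zero)) ⟨
    p * ((u₀ * (1# + u₁ * u₁)) * p)
      ≈⟨ solve 3 (λ p a b → p :* ((a :* (con 1 :+ b :* b)) :* p) := a :* (p :* p :+ (b :* p) :* (b :* p))) refl p u₀ u₁ ⟩
    u₀ * (p * p + (u₁ * p) * (u₁ * p))   ≈⟨ *-congˡ (+-congˡ (*-cong q≈u₁p q≈u₁p)) ⟨
    u₀ * (p * p + q * q)                 ≈⟨ *-congˡ (at-P v (suc m)) ⟨
    u₀ * at v (P (suc (suc (suc m))))    ∎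
    where
    v  = u (fromℕ (suc (suc m)))
    u₀ = u zero
    u₁ = u (suc zero)
    p  = at v (P (suc (suc m)))
    q  = at v (Q (suc (suc m)))

    q≈u₁p : q ≈ u₁ * p
    q≈u₁p = Q≈u₀P m (u ∘ suc) (step ∘ suc)

-- `num k` and `den k` are √x^(2^k) Pₖ₊₁(z/√x) and √x^(2^k - 1) Qₖ₊₁(z/√x),
-- rescaled so that only integral powers of x occur.
module Homogenised (A : RawRing 0ℓ 0ℓ) (x z : RawRing.Carrier A) where
  open RawRing A

  mutual
    num : ℕ → Carrier
    num zero    = z
    num (suc k) = num k * num k + x * (den k * den k)

    den : ℕ → Carrier
    den zero    = 1#
    den (suc k) = num k * den k

-- Clearing the powers of √x

module Clearing {c ℓ} (S : CommutativeRing c ℓ) {φ : ℤ → CommutativeRing.Carrier S}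
  (φ-homo : IsRingHomomorphism +-*-rawRing (CommutativeRing.rawRing S) φ)
  {A : RawRing 0ℓ 0ℓ} {ψ : RawRing.Carrier A → CommutativeRing.Carrier S}
  (ψ-homo : IsRingHomomorphism A (CommutativeRing.rawRing S) ψ) (x z : RawRing.Carrier A)
  where

  open CommutativeRing S hiding (zero)
  open SemiringSolver commutativeSemiring using (solve; _:=_; _:+_; _:*_; con)
  open Exp semiring using (_^_; ^-homo-*; ^-congʳ)
  open RingProperties ring using (-‿distribʳ-*)
  open import Relation.Binary.Reasoning.Setoid setoid
  open EvaluatePQ S φ-homo
  open Homogenised A x z
  private
    module A = RawRing A
    module ψ = IsRingHomomorphism ψ-homo

  module _ {X y y⁻¹ Z : Carrier} (X≈yy : X ≈ y * y) (y⁻¹y≈1 : y⁻¹ * y ≈ 1#)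
    (ψx≈X : ψ x ≈ X) (ψz≈Z : ψ z ≈ Z) where

    private
      u : Carrier
      u = Z * y⁻¹

      yu≈ψz : y * u ≈ ψ z
      yu≈ψz = begin
        y * (Z * y⁻¹)    ≈⟨ solve 3 (λ y Z i → y :* (Z :* i) := (i :* y) :* Z) refl y Z y⁻¹ ⟩
        (y⁻¹ * y) * Z    ≈⟨ *-congʳ y⁻¹y≈1 ⟩
        1# * Z           ≈⟨ *-identityˡ Z ⟩
        Z                ≈⟨ ψz≈Z ⟨
        ψ z              ∎

    ψ-num : ∀ k → ψ (num (suc k)) ≈ ψ (num k) * ψ (num k) + X * (ψ (den k) * ψ (den k))
    ψ-num k = trans (ψ.+-homo _ _) (+-cong (ψ.*-homo _ _)
      (trans (ψ.*-homo _ _) (*-cong ψx≈X (ψ.*-homo _ _))))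

    X^2^-suc : ∀ m → X ^ (2 ℕ^ suc m) ≈ X ^ (2 ℕ^ m) * X ^ (2 ℕ^ m)
    X^2^-suc m = trans (^-congʳ X (≡.cong (2 ℕ^ m ℕ+_) (ℕ.+-identityʳ (2 ℕ^ m)))) (^-homo-* X (2 ℕ^ m) (2 ℕ^ m))

    mutual
      -- The recursions multiply values in pairs, and the prefactor squares along with them. The
      -- induction starts at P₂ and Q₂ because the prefactor of P₁ would be y, which is not a power
      -- of X.
      clear-P : ∀ m → X ^ (2 ℕ^ m) * at u (P (suc (suc m))) ≈ ψ (num (suc m))
      clear-P zero = begin
        (X * 1#) * at u (P 2)
          ≈⟨ *-congˡ (at-P u 0) ⟩
        (X * 1#) * (at u (P 1) * at u (P 1) + at u (Q 1) * at u (Q 1))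
          ≈⟨ *-congˡ (+-cong (*-cong (at-P₁ u) (at-P₁ u)) (*-cong (at-Q₁ u) (at-Q₁ u))) ⟩
        (X * 1#) * (u * u + 1# * 1#)
          ≈⟨ solve 2 (λ X u → (X :* con 1) :* (u :* u :+ con 1 :* con 1) := X :* (u :* u) :+ X :* (con 1 :* con 1)) refl X u ⟩
        X * (u * u) + X * (1# * 1#)
          ≈⟨ +-congʳ (*-congʳ X≈yy) ⟩
        (y * y) * (u * u) + X * (1# * 1#)
          ≈⟨ +-congʳ (solve 2 (λ y u → (y :* y) :* (u :* u) := (y :* u) :* (y :* u)) refl y u) ⟩
        (y * u) * (y * u) + X * (1# * 1#)
          ≈⟨ +-cong (*-cong yu≈ψz yu≈ψz) (*-congˡ (*-cong (sym ψ.1#-homo) (sym ψ.1#-homo))) ⟩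
        ψ z * ψ z + X * (ψ A.1# * ψ A.1#)
          ≈⟨ ψ-num 0 ⟨
        ψ (num 1) ∎
      clear-P (suc m) = begin
        X ^ (2 ℕ^ suc m) * at u (P (suc (suc (suc m))))
          ≈⟨ *-cong (X^2^-suc m) (at-P u (suc m)) ⟩
        (W * W) * (p * p + q * q)
          ≈⟨ solve 3 (λ W p q → (W :* W) :* (p :* p :+ q :* q) := (W :* p) :* (W :* p) :+ (W :* q) :* (W :* q)) refl W p q ⟩
        (W * p) * (W * p) + (W * q) * (W * q)
          ≈⟨ +-cong (*-cong (clear-P m) (clear-P m)) (*-cong (clear-Q m) (clear-Q m)) ⟩
        n * n + (y * d) * (y * d)
          ≈⟨ +-congˡ (solve 2 (λ y d → (y :* d) :* (y :* d) := (y :* y) :* (d :* d)) refl y d) ⟩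
        n * n + (y * y) * (d * d)
          ≈⟨ +-congˡ (*-congʳ X≈yy) ⟨
        n * n + X * (d * d)
          ≈⟨ ψ-num (suc m) ⟨
        ψ (num (suc (suc m))) ∎
        where
        W = X ^ (2 ℕ^ m)
        p = at u (P (suc (suc m)))
        q = at u (Q (suc (suc m)))
        n = ψ (num (suc m))
        d = ψ (den (suc m))

      -- One y is left over since Q has degree one less than P. Its square supplies the x in `num`,
      -- and in `clear` it meets the y⁻¹ in front of Q.
      clear-Q : ∀ m → X ^ (2 ℕ^ m) * at u (Q (suc (suc m))) ≈ y * ψ (den (suc m))
      clear-Q zero = begin
        (X * 1#) * at u (Q 2)
          ≈⟨ *-cong (*-congʳ X≈yy) (trans (at-Q u 0) (*-cong (at-P₁ u) (at-Q₁ u))) ⟩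
        ((y * y) * 1#) * (u * 1#)
          ≈⟨ solve 2 (λ y u → ((y :* y) :* con 1) :* (u :* con 1) := y :* ((y :* u) :* con 1)) refl y u ⟩
        y * ((y * u) * 1#)
          ≈⟨ *-congˡ (*-cong yu≈ψz (sym ψ.1#-homo)) ⟩
        y * (ψ z * ψ A.1#)
          ≈⟨ *-congˡ (ψ.*-homo z A.1#) ⟨
        y * ψ (den 1) ∎
      clear-Q (suc m) = begin
        X ^ (2 ℕ^ suc m) * at u (Q (suc (suc (suc m))))
          ≈⟨ *-cong (X^2^-suc m) (at-Q u (suc m)) ⟩
        (W * W) * (p * q)
          ≈⟨ solve 3 (λ W p q → (W :* W) :* (p :* q) := (W :* p) :* (W :* q)) refl W p q ⟩
        (W * p) * (W * q)
          ≈⟨ *-cong (clear-P m) (clear-Q m) ⟩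
        n * (y * d)
          ≈⟨ solve 3 (λ n y d → n :* (y :* d) := y :* (n :* d)) refl n y d ⟩
        y * (n * d)
          ≈⟨ *-congˡ (ψ.*-homo _ _) ⟨
        y * ψ (den (suc (suc m))) ∎
        where
        W = X ^ (2 ℕ^ m)
        p = at u (P (suc (suc m)))
        q = at u (Q (suc (suc m)))
        n = ψ (num (suc m))
        d = ψ (den (suc m))

    clear : ∀ m → X ^ (2 ℕ^ m) * (y⁻¹ * at u (Q (suc (suc m))) + - at u (P (suc (suc m)))) ≈
                  ψ (den (suc m) A.+ A.- num (suc m))
    clear m = begin
      W * (y⁻¹ * q + - p)              ≈⟨ distribˡ W (y⁻¹ * q) (- p) ⟩
      W * (y⁻¹ * q) + W * - p
        ≈⟨ +-cong (solve 3 (λ W i q → W :* (i :* q) := i :* (W :* q)) refl W y⁻¹ q) (sym (-‿distribʳ-* W p)) ⟩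
      y⁻¹ * (W * q) + - (W * p)        ≈⟨ +-cong (*-congˡ (clear-Q m)) (-‿cong (clear-P m)) ⟩
      y⁻¹ * (y * d) + - n              ≈⟨ +-congʳ (*-assoc y⁻¹ y d) ⟨
      (y⁻¹ * y) * d + - n              ≈⟨ +-congʳ (trans (*-congʳ y⁻¹y≈1) (*-identityˡ d)) ⟩
      d + - n                          ≈⟨ +-congˡ (ψ.-‿homo _) ⟨
      d + ψ (A.- num (suc m))          ≈⟨ ψ.+-homo _ _ ⟨
      ψ (den (suc m) A.+ A.- num (suc m)) ∎
      where
      W = X ^ (2 ℕ^ m)
      p = at u (P (suc (suc m)))
      q = at u (Q (suc (suc m)))
      n = ψ (num (suc m))
      d = ψ (den (suc m))

-- Vanishing of the left-hand side

module Vanishing {c ℓ} (S : CommutativeRing c ℓ) {φ : ℤ → CommutativeRing.Carrier S}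
  (φ-homo : IsRingHomomorphism +-*-rawRing (CommutativeRing.rawRing S) φ) where

  open CommutativeRing S hiding (zero)
  open SemiringSolver commutativeSemiring using (solve; _:=_; _:+_; _:*_)
  open import Relation.Binary.Reasoning.Setoid setoid
  open EvaluatePQ S φ-homo

  evaluate-cong : ∀ {u v} → u ≈ v → ∀ p → at u p ≈ at v p
  evaluate-cong u≈v []      = refl
  evaluate-cong u≈v (a ∷ p) = +-congˡ (*-cong u≈v (evaluate-cong u≈v p))

  module _ {X y y⁻¹ : Carrier} (X≈yy : X ≈ y * y) (y⁻¹y≈1 : y⁻¹ * y ≈ 1#) where

    -- This is the hypothesis divided by y³.
    step : ∀ {a b} → a * (b * b + X) ≈ X * b → (a * y⁻¹) * (1# + (b * y⁻¹) * (b * y⁻¹)) ≈ b * y⁻¹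
    step {a} {b} p = begin
      (a * y⁻¹) * (1# + (b * y⁻¹) * (b * y⁻¹))
        -- The 1 is written as (y⁻¹ y)² so that y⁻³ factors out of the whole product.
        ≈⟨ *-congˡ (+-congʳ (trans (*-cong y⁻¹y≈1 y⁻¹y≈1) (*-identityˡ 1#))) ⟨
      (a * y⁻¹) * ((y⁻¹ * y) * (y⁻¹ * y) + (b * y⁻¹) * (b * y⁻¹))
        ≈⟨ solve 4 (λ a b y i → (a :* i) :* ((i :* y) :* (i :* y) :+ (b :* i) :* (b :* i)) :=
                     (i :* i :* i) :* (a :* (b :* b :+ y :* y))) refl a b y y⁻¹ ⟩
      (y⁻¹ * y⁻¹ * y⁻¹) * (a * (b * b + y * y))
        ≈⟨ *-congˡ (*-congˡ (+-congˡ X≈yy)) ⟨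
      (y⁻¹ * y⁻¹ * y⁻¹) * (a * (b * b + X))
        ≈⟨ *-congˡ p ⟩
      (y⁻¹ * y⁻¹ * y⁻¹) * (X * b)
        ≈⟨ *-congˡ (*-congʳ X≈yy) ⟩
      (y⁻¹ * y⁻¹ * y⁻¹) * ((y * y) * b)
        ≈⟨ solve 3 (λ b y i → (i :* i :* i) :* ((y :* y) :* b) := (i :* y) :* ((i :* y) :* (b :* i))) refl b y y⁻¹ ⟩
      (y⁻¹ * y) * ((y⁻¹ * y) * (b * y⁻¹))
        ≈⟨ trans (*-cong y⁻¹y≈1 (trans (*-congʳ y⁻¹y≈1) (*-identityˡ _))) (*-identityˡ _) ⟩
      b * y⁻¹ ∎

    module _ {c′ ℓ′} (K : CommutativeRing c′ ℓ′) {ι : CommutativeRing.Carrier K → Carrier}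
      (ι-homo : IsRingHomomorphism (CommutativeRing.rawRing K) rawRing ι) where
      private
        module K = CommutativeRing K
        module ι = IsRingHomomorphism ι-homo

      -- The relations between neighbours hold in K, where x may have no square root, and are
      -- carried along `ι` to where y exists. As `e zero` goes to y², the first term of the rescaled
      -- sequence is y, and y⁻¹ Q becomes P.
      vanish : ∀ m (e : Fin (suc (suc m)) → K.Carrier) → ι (e zero) ≈ X →
               (∀ i → e (inject₁ i) K.* (e (suc i) K.* e (suc i) K.+ e zero) K.≈ e zero K.* e (suc i)) →
               ∀ {f} → f K.≈ e (fromℕ (suc m)) → ∀ w →
               w * (y⁻¹ * at (ι f * y⁻¹) (Q (suc (suc m))) + - at (ι f * y⁻¹) (P (suc (suc m)))) ≈ 0#
      vanish m e ιe₀≈X neighbours {f} f≈e w = begin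
        w * (y⁻¹ * at (ι f * y⁻¹) Qₘ + - at (ι f * y⁻¹) Pₘ)
          ≈⟨ *-congˡ (+-cong (*-congˡ (evaluate-cong v≈u Qₘ)) (-‿cong (evaluate-cong v≈u Pₘ))) ⟩
        w * (y⁻¹ * at u Qₘ + - at u Pₘ)
          ≈⟨ *-congˡ (+-congʳ (begin
               y⁻¹ * at u Qₘ
                 ≈⟨ *-congˡ (Q≈u₀P m (λ i → ι (e i) * y⁻¹) (λ i → step (ι-neighbours i))) ⟩
               y⁻¹ * ((ι (e zero) * y⁻¹) * at u Pₘ)
                 ≈⟨ *-congˡ (*-congʳ (*-congʳ (trans ιe₀≈X X≈yy))) ⟩
               y⁻¹ * (((y * y) * y⁻¹) * at u Pₘ)
                 ≈⟨ solve 3 (λ y i p → i :* (((y :* y) :* i) :* p) := (i :* y) :* ((i :* y) :* p)) refl y y⁻¹ (at u Pₘ) ⟩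
               (y⁻¹ * y) * ((y⁻¹ * y) * at u Pₘ)
                 ≈⟨ trans (*-cong y⁻¹y≈1 (trans (*-congʳ y⁻¹y≈1) (*-identityˡ _))) (*-identityˡ _) ⟩
               at u Pₘ ∎)) ⟩
        w * (at u Pₘ + - at u Pₘ)
          ≈⟨ *-congˡ (-‿inverseʳ (at u Pₘ)) ⟩
        w * 0#
          ≈⟨ zeroʳ w ⟩
        0# ∎
        where
        u  = ι (e (fromℕ (suc m))) * y⁻¹
        Pₘ = P (suc (suc m))
        Qₘ = Q (suc (suc m))

        v≈u : ι f * y⁻¹ ≈ u
        v≈u = *-congʳ (ι.⟦⟧-cong f≈e)

        ι-neighbours : ∀ i → ι (e (inject₁ i)) * (ι (e (suc i)) * ι (e (suc i)) + X) ≈ X * ι (e (suc i))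
        ι-neighbours i = begin
          ι a * (ι b * ι b + X)
            ≈⟨ *-congˡ (trans (ι.+-homo (b K.* b) (e zero)) (+-cong (ι.*-homo b b) ιe₀≈X)) ⟨
          ι a * ι (b K.* b K.+ e zero)        ≈⟨ ι.*-homo a (b K.* b K.+ e zero) ⟨
          ι (a K.* (b K.* b K.+ e zero))      ≈⟨ ι.⟦⟧-cong (neighbours i) ⟩
          ι (e zero K.* b)                    ≈⟨ ι.*-homo (e zero) b ⟩
          ι (e zero) * ι b                    ≈⟨ *-congʳ ιe₀≈X ⟩
          X * ι b                             ∎
          where
          a = e (inject₁ i)
          b = e (suc i)

-- The functional equation of colored trees

module PrefixSums {c ℓ} (S : CommutativeRing c ℓ) where
  open CommutativeRing S hiding (zero)
  open MonoidSum +-commutativeMonoid using (sum; sum-cong-≋; sum-replicate-zero)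
  open SemiringSolver commutativeSemiring using (solve; _:=_; _:+_; _:*_)
  open GroupProperties +-abelianGroup using (∙-cancelʳ)
  open import Relation.Binary.Reasoning.Setoid setoid

  _when_ : Carrier → Bool → Carrier
  f when b = if b then f else 0#

  prefixSum : ∀ {m} → (Fin m → Carrier) → Fin (suc m) → Carrier
  prefixSum         f zero    = 0#
  prefixSum {suc m} f (suc i) = f zero + prefixSum (f ∘ suc) i

  prefixSum-suc : ∀ {m} (f : Fin m → Carrier) i → prefixSum f (suc i) ≈ prefixSum f (inject₁ i) + f i
  prefixSum-suc f zero    = +-comm (f zero) 0#
  prefixSum-suc f (suc i) = trans (+-congˡ (prefixSum-suc (f ∘ suc) i)) (sym (+-assoc _ _ _))

  suc≤?suc : ∀ {m} (j i : Fin m) → does (suc j ≤? suc i) ≡ does (j ≤? i)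
  suc≤?suc zero    i = ≡.refl
  suc≤?suc (suc j) i = ≡.refl

  -- Row `i` of the matrix allows the colors up to and including `i`, hence the prefix index
  -- `suc i`.
  sum-≤ : ∀ {m} (f : Fin m → Carrier) i → sum (λ j → f j when does (j ≤? i)) ≈ prefixSum f (suc i)
  sum-≤ {suc m} f zero    = +-congˡ (sum-replicate-zero m)
  sum-≤ {suc m} f (suc i) = +-congˡ (trans
    (sum-cong-≋ λ j → reflexive (≡.cong (f (suc j) when_) (suc≤?suc j i)))
    (sum-≤ (f ∘ suc) i))

  -- Index zero is prepended with value x so that the lowest color also has a lower neighbour.
  module _ {m} (x : Carrier) (f : Fin m → Carrier)
    (equation : ∀ i → f i ≈ x + sum (λ j → f j when does (j ≤? i)) * f i) where

    extend : Fin (suc m) → Carrier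
    extend zero    = x
    extend (suc i) = f i

    extend-equation : ∀ i → extend i ≈ x + prefixSum f i * extend i
    extend-equation zero    = sym (trans (+-congˡ (zeroˡ x)) (+-identityʳ x))
    extend-equation (suc i) = trans (equation i) (+-congˡ (*-congʳ (sum-≤ f i)))

    -- Multiplying the equation of each neighbour by the other neighbour computes ab in two ways.
    -- The unknown prefix sum s enters both only through the term sab, which additive cancellation
    -- removes.
    extend-neighbours : ∀ i → extend (inject₁ i) * (f i * f i + x) ≈ x * f i
    extend-neighbours i = ∙-cancelʳ (s * a * b) _ _ (begin
      a * (b * b + x) + s * a * b
        ≈⟨ solve 4 (λ x s a b → a :* (b :* b :+ x) :+ s :* a :* b := a :* (x :+ (s :+ b) :* b)) refl x s a b ⟩
      a * (x + (s + b) * b)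
        ≈⟨ *-congˡ (trans (extend-equation (suc i)) (+-congˡ (*-congʳ (prefixSum-suc f i)))) ⟨
      a * b
        ≈⟨ *-congʳ (extend-equation (inject₁ i)) ⟩
      (x + s * a) * b
        ≈⟨ distribʳ b x (s * a) ⟩
      x * b + s * a * b ∎)
      where
      a = extend (inject₁ i)
      b = f i
      s = prefixSum f (inject₁ i)

-- Enumeration of colored trees

module Counting where
  open Series
  open PrefixSums powerSeriesRing using (_when_)
  open MonoidSum (CommutativeRing.+-commutativeMonoid powerSeriesRing) using (sum)
  open ≡.≡-Reasoning

  -- The recursion in `finite-forest` carries a bound, so the enumerations of smaller forests met
  -- there are not those that `t` counts with. Independence of the enumeration permits the switch to
  -- `firstTreeAndRest`, which is built from `forest`.
  card-unique : ∀ {X} (a b : Finite X) → ∣ a ∣ ≡ ∣ b ∣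
  card-unique (_ , X↔k) (_ , X↔l) = ↔⇒≡ (X↔l ↔-∘ ↔-sym X↔k)

  card-ΣFin : ∀ m {X : Fin m → Set} (fin : ∀ j → Finite (X j)) (f : Fin m → PowerSeries) g n →
              (∀ j → + ∣ fin j ∣ ≡ (f j * g) n) → + ∣ finite-ΣFin m fin ∣ ≡ (sum f * g) n
  card-ΣFin zero    fin f g n eq = ≡.sym (zeroˡ 0# g constant-0 n)
  card-ΣFin (suc m) fin f g n eq = begin
    + ∣ fin zero ∣ ℤ.+ + ∣ finite-ΣFin m (fin ∘ suc) ∣
      ≡⟨ ≡.cong₂ ℤ._+_ (eq zero) (card-ΣFin m (fin ∘ suc) (f ∘ suc) g n (eq ∘ suc)) ⟩
    (f zero * g) n ℤ.+ (sum (f ∘ suc) * g) n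
      ≡⟨ distribʳ g (f zero) (sum (f ∘ suc)) n ⟨
    (sum f * g) n ∎

  card-ΣFin-cong : ∀ m {X Y : Fin m → Set} (a : ∀ j → Finite (X j)) (b : ∀ j → Finite (Y j)) →
                   (∀ j → ∣ a j ∣ ≡ ∣ b j ∣) → ∣ finite-ΣFin m a ∣ ≡ ∣ finite-ΣFin m b ∣
  card-ΣFin-cong zero    a b eq = ≡.refl
  card-ΣFin-cong (suc m) a b eq = ≡.cong₂ _ℕ+_ (eq zero) (card-ΣFin-cong m (a ∘ suc) (b ∘ suc) (eq ∘ suc))

  sucSplit : ∀ {n} → Split n → Split (suc n)
  sucSplit (k , l , e) = suc k , l , ≡.cong suc e

  -- The bijection in `finite-Split` matches on the proof stored in a split, so it computes only
  -- once that proof is `refl`.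
  fromSplit-suc : ∀ n i → Inverse.from (proj₂ (finite-Split (suc n))) (suc i) ≡
                          sucSplit (Inverse.from (proj₂ (finite-Split n)) i)
  fromSplit-suc n i with Inverse.from (proj₂ (finite-Split n)) i
  ... | k , l , ≡.refl = ≡.refl

  -- `finite-Split` lists the splits by increasing first part, in the order of the terms of the
  -- convolution, so the split with first part zero can be peeled off on both sides.
  card-Split : ∀ n {X : Split n → Set} (fin : ∀ s → Finite (X s)) f g →
               (∀ k l e → + ∣ fin (k , l , e) ∣ ≡ f k ℤ.* g l) →
               + ∣ finite-Σ (finite-Split n) fin ∣ ≡ (f * g) n
  card-Split zero    fin f g eq = ≡.cong (ℤ._+ 0ℤ) (eq 0 0 ≡.refl)
  card-Split (suc n) fin f g eq = ≡.cong₂ ℤ._+_ (eq 0 (suc n) ≡.refl) (begin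
    + ∣ finite-ΣFin _ (λ i → fin (Inverse.from (proj₂ (finite-Split (suc n))) (suc i))) ∣
      ≡⟨ ≡.cong +_ (card-ΣFin-cong (proj₁ (finite-Split n)) _ _ (λ i → ≡.cong (λ s → ∣ fin s ∣) (fromSplit-suc n i))) ⟩
    + ∣ finite-Σ (finite-Split n) (fin ∘ sucSplit) ∣
      ≡⟨ card-Split n (fin ∘ sucSplit) (f ∘ suc) g (λ k l e → eq (suc k) l (≡.cong suc e)) ⟩
    ((f ∘ suc) * g) n ∎)

  when-0 : ∀ f b → f 0 ≡ 0ℤ → (f when b) 0 ≡ 0ℤ
  when-0 f true  p = p
  when-0 f false p = ≡.refl

  sum-0 : ∀ {k} (f : Fin k → PowerSeries) → (∀ j → f j 0 ≡ 0ℤ) → sum f 0 ≡ 0ℤ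
  sum-0 {zero}  f p = ≡.refl
  sum-0 {suc k} f p = ≡.cong₂ ℤ._+_ (p zero) (sum-0 (f ∘ suc) (p ∘ suc))

  *-tails : ∀ f g n → f 0 ≡ 0ℤ → g 0 ≡ 0ℤ → (f * g) (suc (suc n)) ≡ ((f ∘ suc) * (g ∘ suc)) n
  *-tails f g n p q = begin
    f 0 ℤ.* g (suc (suc n)) ℤ.+ ((f ∘ suc) * g) (suc n)
      ≡⟨ ≡.cong₂ ℤ._+_ (≡.cong (ℤ._* g (suc (suc n))) p) (*-suc (f ∘ suc) g n) ⟩
    0ℤ ℤ.+ (((f ∘ suc) * (g ∘ suc)) n ℤ.+ f (suc (suc n)) ℤ.* g 0)
      ≡⟨ ℤ.+-identityˡ _ ⟩
    ((f ∘ suc) * (g ∘ suc)) n ℤ.+ f (suc (suc n)) ℤ.* g 0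
      ≡⟨ ≡.cong (λ a → ((f ∘ suc) * (g ∘ suc)) n ℤ.+ f (suc (suc n)) ℤ.* a) q ⟩
    ((f ∘ suc) * (g ∘ suc)) n ℤ.+ f (suc (suc n)) ℤ.* 0ℤ
      ≡⟨ ≡.cong (ℤ._+_ (((f ∘ suc) * (g ∘ suc)) n)) (ℤ.*-zeroʳ (f (suc (suc n)))) ⟩
    ((f ∘ suc) * (g ∘ suc)) n ℤ.+ 0ℤ
      ≡⟨ ℤ.+-identityʳ _ ⟩
    ((f ∘ suc) * (g ∘ suc)) n ∎

  module _ {m} (A : ColoringMatrix m) where

    treeSeries : Fin m → PowerSeries
    treeSeries i n = + t A i n

    childSeries : Fin m → PowerSeries
    childSeries i = sum (λ j → treeSeries j when A i j)

    forest : ∀ i n → Finite (ColoredForest A i n)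
    forest i n = finite-forest A (suc n) i n (ℕ.n<1+n n)

    first×rest : ∀ i j k l → Finite (A i j ≡ true × ColoredForest A j k × ColoredForest A i l)
    first×rest i j k l = finite-× (finite-Dec (A i j Bool.≟ true) (Decidable⇒UIP.≡-irrelevant Bool._≟_))
                                  (finite-× (forest j k) (forest i l))

    -- Restoring the root turns forests with k and l vertices into trees with one vertex more, hence
    -- `suc k` and `suc l`. A forbidden pair of colors gives a factor zero on both sides.
    card-first×rest : ∀ i j k l →
      + ∣ first×rest i j k l ∣ ≡ (treeSeries j when A i j) (suc k) ℤ.* treeSeries i (suc l)
    card-first×rest i j k l with A i j
    ... | true  = ≡.trans (≡.cong +_ (ℕ.*-identityˡ (∣ forest j k ∣ ℕ.* ∣ forest i l ∣)))
                          (ℤ.pos-* ∣ forest j k ∣ ∣ forest i l ∣)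
    ... | false = ≡.refl

    firstTreeAndRest : ∀ i n → Finite (FirstTreeAndRest A i n)
    firstTreeAndRest i n = finite-ΣFin m λ j → finite-Σ (finite-Split n) λ (k , l , _) → first×rest i j k l

    -- With k + l = n the two trees together have n + 2 vertices. The remaining terms of the
    -- convolution vanish because no tree is empty, which is what `*-tails` expresses.
    card-firstTreeAndRest : ∀ i n → + ∣ firstTreeAndRest i n ∣ ≡ (childSeries i * treeSeries i) (suc (suc n))
    card-firstTreeAndRest i n =
      card-ΣFin m _ (λ j → treeSeries j when A i j) (treeSeries i) (suc (suc n)) λ j → ≡.trans
        (card-Split n (λ (k , l , _) → first×rest i j k l)
          ((treeSeries j when A i j) ∘ suc) (treeSeries i ∘ suc) (λ k l _ → card-first×rest i j k l))
        (≡.sym (*-tails (treeSeries j when A i j) (treeSeries i) n (when-0 (treeSeries j) (A i j) ≡.refl) ≡.refl))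

    treeSeries-equation : ∀ i → treeSeries i ≈ indeterminate + childSeries i * treeSeries i
    treeSeries-equation i zero = ≡.sym (≡.trans (ℤ.+-identityˡ _)
      (≡.trans (ℤ.+-identityʳ _) (ℤ.*-zeroʳ (childSeries i 0))))
    -- The one-vertex tree accounts for x; the product begins in degree two, as both factors have
    -- constant term zero.
    treeSeries-equation i (suc zero) = ≡.cong (ℤ._+_ 1ℤ) (≡.sym (begin
      childSeries i 0 ℤ.* 1ℤ ℤ.+ (childSeries i 1 ℤ.* 0ℤ ℤ.+ 0ℤ)
        ≡⟨ ≡.cong₂ (λ a b → a ℤ.* 1ℤ ℤ.+ (b ℤ.+ 0ℤ))
             (sum-0 (λ j → treeSeries j when A i j) (λ j → when-0 (treeSeries j) (A i j) ≡.refl))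
             (ℤ.*-zeroʳ (childSeries i 1)) ⟩
      0ℤ ∎))
    treeSeries-equation i (suc (suc n)) = begin
      + ∣ forest i (suc n) ∣
        ≡⟨ ≡.cong +_ (card-unique (forest i (suc n)) (finite-↔ (forest↔first×rest A) (firstTreeAndRest i n))) ⟩
      + ∣ firstTreeAndRest i n ∣
        ≡⟨ card-firstTreeAndRest i n ⟩
      (childSeries i * treeSeries i) (suc (suc n))
        ≡⟨ ℤ.+-identityˡ _ ⟨
      (indeterminate + childSeries i * treeSeries i) (suc (suc n)) ∎

-- Laurent series in √x

module _ where
  open RawRing laurentSeries

  √x : LaurentSeries
  √x = y^- 0 · shift 1 (constant 1ℤ)

  -- Inside a Laurent series the coefficients `shift 1 (constant 1ℤ)` stand for y, so both sides are
  -- y².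
  x≈√x√x : inSqrt indeterminate ≈ √x * √x
  x≈√x√x zero          = ≡.refl
  x≈√x√x (suc zero)    = ≡.refl
  x≈√x√x (suc (suc n)) = ≡.trans (SubstSquare.substSquare-constant 1ℤ n)
    (≡.sym (≡.trans (Counting.*-tails indeterminate indeterminate n ≡.refl ≡.refl) (Series.*-identityˡ (constant 1ℤ) n)))

  -- Once the pole is cleared, the equation reads 1 · y = y.
  1/√x-√x : 1/√x * √x ≈ 1#
  1/√x-√x = Series.*-identityˡ (shift 1 (constant 1ℤ))

-- The polynomial in x and z, and the conclusion

open RawRing laurentSeries using (_≈_; 0#)

coefficients-homo : IsRingHomomorphism +-*-rawRing laurentSeries (inSqrt ∘ constant)
coefficients-homo = Composition.isRingHomomorphism
  (λ {a} {b} {c} → CommutativeRing.trans laurentSeriesRing {a} {b} {c})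
  constant-isRingHomomorphism inSqrt-isRingHomomorphism

ℤ[x] ℤ[x,z] : RawRing 0ℓ 0ℓ
ℤ[x]   = polynomials +-*-rawRing
ℤ[x,z] = polynomials ℤ[x]

ℤ[x]-homo : IsRingHomomorphism ℤ[x] powerSeries (evaluate powerSeries constant indeterminate)
ℤ[x]-homo = Evaluation.evaluate-isRingHomomorphism powerSeriesRing constant-isRingHomomorphism indeterminate

-- Outer lists run over powers of z, inner lists over powers of x. The entry `[]` is the zero of
-- ℤ[x], so that `zₚ` has exactly the form treated by `evaluate-indeterminate`.
xₚ zₚ : Polynomial (Polynomial ℤ)
xₚ = (0ℤ ∷ 1ℤ ∷ []) ∷ []
zₚ = [] ∷ (1ℤ ∷ []) ∷ []

evaluate₂-homo : ∀ G → IsRingHomomorphism ℤ[x,z] laurentSeries (λ R → inSqrt (evaluate₂ R G))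
evaluate₂-homo G = Composition.isRingHomomorphism
  (λ {a} {b} {c} → CommutativeRing.trans laurentSeriesRing {a} {b} {c})
  (Evaluation.evaluate-isRingHomomorphism powerSeriesRing ℤ[x]-homo G)
  inSqrt-isRingHomomorphism

evaluate₂-x : ∀ G → inSqrt (evaluate₂ xₚ G) ≈ inSqrt indeterminate
evaluate₂-x G = SubstSquare.substSquare-cong λ n → ≡.trans
  (Evaluation.evaluate-const powerSeriesRing ℤ[x]-homo G (0ℤ ∷ 1ℤ ∷ []) n)
  (Evaluation.evaluate-indeterminate powerSeriesRing constant-isRingHomomorphism indeterminate n)

evaluate₂-z : ∀ G → inSqrt (evaluate₂ zₚ G) ≈ inSqrt G
evaluate₂-z G = SubstSquare.substSquare-cong
  (Evaluation.evaluate-indeterminate powerSeriesRing ℤ[x]-homo G)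

theorem43 : (m : ℕ) .{{_ : NonZero m}} →
    leftHandSide m (F m) ≈ 0#
    × Σ (Polynomial (Polynomial ℤ)) (λ R →
    (G : PowerSeries) → leftHandSide m G ≈ inSqrt (evaluate₂ R G))
theorem43 (suc m) =
    Vanishing.vanish laurentSeriesRing coefficients-homo {x} {√x} {1/√x} x≈√x√x 1/√x-√x
      powerSeriesRing inSqrt-isRingHomomorphism
      m (extend indeterminate T T-equation) (λ n → ≡.refl) (extend-neighbours indeterminate T T-equation)
      -- `F` has its coefficient at index zero from a separate clause, so it is matched with the
      -- series of the last color coefficient by coefficient.
      {F (suc m)} (λ { zero → ≡.refl ; (suc n) → ≡.refl }) (x ^ (2 ℕ^ m))
  -- The witness is x^(2^m) (Q/√x - P) at z/√x in homogenised form, where index `suc m` belongs to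
  -- Pₘ₊₂ and Qₘ₊₂. The series G enters only as the value of z.
  , den (suc m) +₂ -₂ num (suc m)
  , λ G → Clearing.clear laurentSeriesRing coefficients-homo (evaluate₂-homo G) xₚ zₚ
      {x} {√x} {1/√x} {inSqrt G} x≈√x√x 1/√x-√x (evaluate₂-x G) (evaluate₂-z G) m
  where
  open Exp (CommutativeRing.semiring laurentSeriesRing) using (_^_)
  open RawRing ℤ[x,z] using () renaming (_+_ to _+₂_; -_ to -₂_)
  open Homogenised ℤ[x,z] xₚ zₚ using (num; den)
  open PrefixSums powerSeriesRing using (extend; extend-neighbours)

  x : LaurentSeries
  x = inSqrt indeterminate

  T : Fin (suc m) → PowerSeries
  T = Counting.treeSeries (B (suc m))

  T-equation = Counting.treeSeries-equation (B (suc m))
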